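{- A connected graph $G$ is a cograph if and only if its split tree $ST(G)$ is equal (as a graph-labelled tree, up to isomorphism fixing the leaves) to its modular graph-labelled tree, and this tree is a clique-star tree (all labels are cliques or stars).
   Context: A cograph is a graph with no induced path on four vertices. A graph-labelled tree $(T,\mathcal{F})$: a tree $T$ whose internal vertices (nodes) $v$ of degree $k$ carry a graph $G_v$ on $k$ marker vertices and a bijection $\rho_v$ from tree-edges at $v$ to $V(G_v)$; for a leaf $l$, a node or leaf $u\ne l$ is $l$-accessible if for consecutive tree-edges $e=wv,e'=vw'$ on the $l,u$-path, $\rho_v(e)\rho_v(e')\in E(G_v)$; the accessibility graph has the leaves as vertices, $x,y$ adjacent iff $y$ is $x$-accessible. A split of $H$ is a bipartition $(V_1,V_2)$ of $V(H)$, $|V_i|\ge 2$, such that every vertex of $V_2$ with a neighbour in $V_1$ is adjacent to every vertex of $V_1$ with a neighbour in $V_2$; prime = no split; degenerate = clique or star ($K_{1,m}$, with centre the universal vertex). Reduced: all nodes of degree $\ge3$, no two adjacent clique nodes, no adjacent star nodes $u,v$ with $\rho_u(uv)$ the centre of $G_u$ and $\rho_v(uv)$ an extremity of $G_v$. The split tree $ST(G)$ is the unique reduced graph-labelled tree with accessibility graph $G$ whose labels are prime or degenerate. Modular graph-labelled tree: let $MD(G)$ be Gallai's canonical modular decomposition tree of $G$ (leaves $V(G)$, each internal node $u$ labelled by the quotient graph $G/\mathcal{P}_u$ of the partition into the leaf sets of its children, series/parallel nodes labelled by cliques/stables). The tree $T$ is the tree underlying $MD(G)$, except that if the root has exactly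 two children one root-incident edge is contracted. Each non-root node $u$ of $MD(G)$ gets label $G/\mathcal{P}_u$ plus an extra universal marker vertex mapped to the edge from $u$ to its parent; the root (if not contracted) gets label $G/\mathcal{P}_{root}$, markers mapped to the child edges. -}

module Defs where

open import Data.Nat using (ℕ; _≤_)
open import Data.Fin using (Fin; _≟_)
open import Relation.Nullary.Decidable using (⌊_⌋)
open import Data.Bool using (Bool; true; false)
open import Data.List using (List; []; _∷_)
open import Data.List.Relation.Unary.Unique.Propositional using (Unique)
open import Data.Product using (Σ; ∃; ∃-syntax; _×_; _,_)
open import Data.Sum using (_⊎_)
open import Relation.Nullary using (¬_)
open import Relation.Binary.PropositionalEquality using (_≡_; _≢_)
open import Function.Bundles using (_⇔_)

record Graph : Set where
  field
    n       : ℕ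
    adj     : Fin n → Fin n → Bool
    adj-sym : ∀ x y → adj x y ≡ adj y x
    adj-irr : ∀ x → adj x x ≡ false

data Walk {k : ℕ} (E : Fin k → Fin k → Bool) : Fin k → Fin k → List (Fin k) → Set where
  here : ∀ {a} → Walk E a a (a ∷ [])
  step : ∀ {a x b ps} → E a x ≡ true → Walk E x b ps → Walk E a b (a ∷ ps)

Path : {k : ℕ} → (Fin k → Fin k → Bool) → Fin k → Fin k → List (Fin k) → Set
Path E a b ps = Walk E a b ps × Unique ps

Connected : Graph → Set
Connected G = (1 ≤ Graph.n G) × (∀ x y → ∃[ ps ] Path (Graph.adj G) x y ps)

Cograph : Graph → Set
Cograph G = ¬ (∃[ a ] ∃[ b ] ∃[ c ] ∃[ d ]
  ( a ≢ b × a ≢ c × a ≢ d × b ≢ c × b ≢ d × c ≢ d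
  × adj a b ≡ true × adj b c ≡ true × adj c d ≡ true
  × adj a c ≡ false × adj a d ≡ false × adj b d ≡ false))
  where open Graph G

-- Graphs on a subset S of Fin k (used for node labels: the marker
-- vertices of the label of node v are identified with the tree-neighbours
-- of v, i.e. ρ_v(vu) is represented by u).

Mem : {k : ℕ} → (Fin k → Bool) → Fin k → Set
Mem S u = S u ≡ true

IsCliqueOn : {k : ℕ} → (Fin k → Bool) → (Fin k → Fin k → Bool) → Set
IsCliqueOn S e = ∀ u w → Mem S u → Mem S w → u ≢ w → e u w ≡ true

IsStarCentredOn : {k : ℕ} → (Fin k → Bool) → (Fin k → Fin k → Bool) → Fin k → Set
IsStarCentredOn S e c =
  Mem S c
  × (∀ u → Mem S u → u ≢ c → e c u ≡ true)
  × (∀ u w → Mem S u → Mem S w → u ≢ c → w ≢ c → e u w ≡ false)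

IsStarOn : {k : ℕ} → (Fin k → Bool) → (Fin k → Fin k → Bool) → Set
IsStarOn S e = ∃[ c ] IsStarCentredOn S e c

DegenerateOn : {k : ℕ} → (Fin k → Bool) → (Fin k → Fin k → Bool) → Set
DegenerateOn S e = IsCliqueOn S e ⊎ IsStarOn S e

SplitOn : {k : ℕ} → (Fin k → Bool) → (Fin k → Fin k → Bool) → (Fin k → Bool) → Set
SplitOn S e P =
  (∃[ a ] ∃[ b ] (a ≢ b × Mem S a × P a ≡ true × Mem S b × P b ≡ true))
  × (∃[ a ] ∃[ b ] (a ≢ b × Mem S a × P a ≡ false × Mem S b × P b ≡ false))
  × (∀ x y → Mem S x → P x ≡ false → Mem S y → P y ≡ true
       → (∃[ y' ] (Mem S y' × P y' ≡ true × e x y' ≡ true))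
       → (∃[ x' ] (Mem S x' × P x' ≡ false × e y x' ≡ true))
       → e x y ≡ true)

PrimeOn : {k : ℕ} → (Fin k → Bool) → (Fin k → Fin k → Bool) → Set
PrimeOn S e = ∀ P → ¬ SplitOn S e P

IsLeaf : {k : ℕ} → (Fin k → Fin k → Bool) → Fin k → Set
IsLeaf E a = ∀ u w → E a u ≡ true → E a w ≡ true → u ≡ w

record GLT (n : ℕ) : Set where
  field
    t        : ℕ
    E        : Fin t → Fin t → Bool
    E-sym    : ∀ a b → E a b ≡ E b a
    E-irr    : ∀ a → E a a ≡ false
    E-conn   : ∀ a b → ∃[ ps ] Path E a b ps
    E-acyc   : ∀ a b ps qs → Path E a b ps → Path E a b qs → ps ≡ qs
    leafOf      : Fin n → Fin t
    leafOf-inj  : ∀ x y → leafOf x ≡ leafOf y → x ≡ y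
    leafOf-leaf : ∀ x → IsLeaf E (leafOf x)
    leafOf-onto : ∀ a → IsLeaf E a → ∃[ x ] leafOf x ≡ a
    -- lab v u w : adjacency in G_v of the markers of tree-edges vu and vw
    lab      : Fin t → Fin t → Fin t → Bool
    lab-sym  : ∀ v u w → lab v u w ≡ lab v w u
    lab-irr  : ∀ v u → lab v u u ≡ false

module _ {n : ℕ} (T : GLT n) where
  open GLT T

  IsNode : Fin t → Set
  IsNode v = ¬ IsLeaf E v

  Nbrs : Fin t → Fin t → Bool
  Nbrs v = E v

  data AccPath : List (Fin t) → Set where
    nil  : AccPath []
    one  : ∀ {x} → AccPath (x ∷ [])
    two  : ∀ {x y} → AccPath (x ∷ y ∷ [])
    more : ∀ {x y z zs} → lab y x z ≡ true → AccPath (y ∷ z ∷ zs) → AccPath (x ∷ y ∷ z ∷ zs)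

  Accessible : Fin t → Fin t → Set
  Accessible l u = ∃[ ps ] (Path E l u ps × AccPath ps)

  Reduced : Set
  Reduced =
    (∀ v → IsNode v → ∃[ a ] ∃[ b ] ∃[ c ]
       (a ≢ b × a ≢ c × b ≢ c × E v a ≡ true × E v b ≡ true × E v c ≡ true))
    × (∀ u v → E u v ≡ true → IsNode u → IsNode v →
         ¬ (IsCliqueOn (Nbrs u) (lab u) × IsCliqueOn (Nbrs v) (lab v)))
    × (∀ u v → E u v ≡ true → IsNode u → IsNode v →
         ¬ (IsStarCentredOn (Nbrs u) (lab u) v
            × ∃[ c ] (IsStarCentredOn (Nbrs v) (lab v) c × c ≢ u)))

  LabelsPrimeOrDegenerate : Set
  LabelsPrimeOrDegenerate = ∀ v → IsNode v →
    PrimeOn (Nbrs v) (lab v) ⊎ DegenerateOn (Nbrs v) (lab v)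

  CliqueStar : Set
  CliqueStar = ∀ v → IsNode v → IsCliqueOn (Nbrs v) (lab v) ⊎ IsStarOn (Nbrs v) (lab v)

AccGraphIs : (G : Graph) → GLT (Graph.n G) → Set
AccGraphIs G T = ∀ x y → x ≢ y →
  (Graph.adj G x y ≡ true ⇔ Accessible T (GLT.leafOf T x) (GLT.leafOf T y))

IsSplitTree : (G : Graph) → GLT (Graph.n G) → Set
IsSplitTree G T = AccGraphIs G T × Reduced T × LabelsPrimeOrDegenerate T

record GLTIso {n : ℕ} (T₁ T₂ : GLT n) : Set where
  private
    module A = GLT T₁
    module B = GLT T₂
  field
    φ     : Fin A.t → Fin B.t
    ψ     : Fin B.t → Fin A.t
    ψφ    : ∀ a → ψ (φ a) ≡ a
    φψ    : ∀ b → φ (ψ b) ≡ b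
    E-pres    : ∀ a b → A.E a b ≡ B.E (φ a) (φ b)
    leaf-pres : ∀ x → φ (A.leafOf x) ≡ B.leafOf x
    lab-pres  : ∀ v u w → A.E v u ≡ true → A.E v w ≡ true →
                A.lab v u w ≡ B.lab (φ v) (φ u) (φ w)

-- Modular decomposition (Gallai): nodes of MD(G) = non-empty strong modules,
-- parent of S = minimal strong module strictly containing S.

module _ (G : Graph) where
  open Graph G

  VSet : Set
  VSet = Fin n → Bool

  _⊆_ : VSet → VSet → Set
  S ⊆ S' = ∀ x → Mem S x → Mem S' x

  _≐_ : VSet → VSet → Set
  S ≐ S' = ∀ x → S x ≡ S' x

  _⊂_ : VSet → VSet → Set
  S ⊂ S' = S ⊆ S' × ∃[ x ] (S' x ≡ true × S x ≡ false)

  full : VSet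
  full _ = true

  IsModule : VSet → Set
  IsModule S = ∀ x y z → Mem S x → Mem S y → S z ≡ false → adj x z ≡ adj y z

  Overlap : VSet → VSet → Set
  Overlap S S' = (∃[ x ] (Mem S x × Mem S' x)) × ¬ (S ⊆ S') × ¬ (S' ⊆ S)

  IsStrong : VSet → Set
  IsStrong S = (∃[ x ] Mem S x) × IsModule S × (∀ S' → IsModule S' → ¬ Overlap S S')

  Child : VSet → VSet → Set
  Child S P = IsStrong S × IsStrong P × S ⊂ P
              × (∀ Q → IsStrong Q → S ⊂ Q → ¬ (Q ⊂ P))

  RootBinary : Set
  RootBinary = ∃[ C₁ ] ∃[ C₂ ] (Child C₁ full × Child C₂ full × ¬ (C₁ ≐ C₂)
                 × (∀ C → Child C full → C ≐ C₁ ⊎ C ≐ C₂))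

  ModAdj : VSet → VSet → Set
  ModAdj S S' = ∃[ x ] ∃[ y ] (Mem S x × Mem S' y × adj x y ≡ true)

  singleton : Fin n → VSet
  singleton x y = ⌊ x ≟ y ⌋

  -- T is the modular graph-labelled tree of G: σ identifies the tree
  -- vertices with the nodes of MD(G) (minus the root when it is binary,
  -- in which case its two children are joined directly); each node's label
  -- is the quotient on its children plus a universal marker for the edge
  -- towards the parent (the other child, if the root was contracted).
  record IsModularGLT (T : GLT n) : Set where
    open GLT T
    field
      σ         : Fin t → VSet
      σ-strong  : ∀ a → IsStrong (σ a)
      σ-inj     : ∀ a b → σ a ≐ σ b → a ≡ b
      σ-onto    : ∀ S → IsStrong S → ¬ (RootBinary × S ≐ full) → ∃[ a ] σ a ≐ S
      σ-noRoot  : RootBinary → ∀ a → ¬ (σ a ≐ full)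
      σ-edge    : ∀ a b → (E a b ≡ true ⇔
                    (Child (σ a) (σ b) ⊎ Child (σ b) (σ a)
                     ⊎ (RootBinary × Child (σ a) full × Child (σ b) full × a ≢ b)))
      σ-leaf    : ∀ x → σ (leafOf x) ≐ singleton x
      σ-lab     : ∀ a u w → E a u ≡ true → E a w ≡ true → u ≢ w →
                    (lab a u w ≡ true ⇔
                      ((σ u ⊆ σ a × σ w ⊆ σ a) → ModAdj (σ u) (σ w)))

{-# OPTIONS --safe #-}
module Submission where

-- If G is a cograph, every label of its split tree is an induced subgraph of G, hence P₄-free,
-- hence has twins, so a prime label has three markers and all labels are cliques or stars. Two stars
-- cannot face each other by extremities, since this gives a P₄; therefore orienting each star
-- towards its centre, and each clique towards the star it hangs from, makes the tree a rooted
-- cotree (the root being a clique node, or an edge that both ends point along). The leaf sets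
-- below its vertices are exactly the strong modules (up to V(G), when the root is an edge), so
-- the split tree is itself a modular graph-labelled tree, and such a tree is determined by the
-- strong modules.
--
-- Conversely, the only modules of a P₄ are trivial, so an induced P₄ of G meets four children of
-- the smallest strong module containing it and reappears in the label of that module; cliques
-- and stars have no induced P₄.

open import Defs
open import Data.Bool using (Bool; true; false; not; _∧_)
import Data.Bool.Properties as Bool
open import Data.Empty using (⊥; ⊥-elim)
open import Data.Fin using (Fin; zero; suc; _≟_)
open import Data.Fin.Properties using (any?; all?)
open import Data.List using (List; []; _∷_; length)
open import Data.List.Membership.Propositional using (_∈_)
open import Data.List.Relation.Unary.All using (All; []; _∷_)
open import Data.List.Relation.Unary.All.Properties using (¬Any⇒All¬)
open import Data.List.Relation.Unary.AllPairs using ([]; _∷_)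
open import Data.List.Relation.Unary.Any as Any using (here; there)
open import Data.List.Relation.Unary.Unique.Propositional using (Unique)
open import Data.Nat using (ℕ; zero; suc; _<_; _≤_; z≤n; s≤s)
import Data.Nat.Properties as ℕ
open import Data.Nat.Induction using (<-wellFounded)
open import Data.Product using (∃-syntax; _×_; _,_; proj₁; proj₂)
open import Data.Sum using (_⊎_; inj₁; inj₂; [_,_]′)
open import Function using (_∘_)
open import Function.Bundles using (_⇔_; mk⇔; Equivalence)
open import Induction.WellFounded using (Acc; acc)
open import Relation.Binary.PropositionalEquality
open import Relation.Nullary using (¬_; Dec; yes; no; does)
open import Relation.Nullary.Decidable using (_×-dec_; _⊎-dec_; _→-dec_; ¬?; dec-true; dec-false; decidable-stable)

-- The trees come without a root, and lists of path vertices are awkward to compare. Both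
-- difficulties are met by one function, the first step `dir p x` from `p` towards `x`. A vertex
-- other than the two ends is interior to a path exactly when it sees the ends in different
-- directions, so accessibility becomes a condition on single vertices (`Linked`), and the leaves
-- below `a` are those that `a` does not see through its parent edge. `Reduced` leaves two ways for
-- adjacent stars to meet. Extremity against extremity is what P₄-freeness excludes; centre against
-- centre survives and is one form of the contracted binary root, which is why the parent relation
-- may hold in both directions along an edge. What `Reduced` does forbid amounts to the alternation
-- of series and parallel nodes along parent edges. That the leaf sets are modules follows from the
-- orientation alone; that they are strong needs this alternation.

true≢false : ∀ {b} → b ≡ true → b ≡ false → ⊥
true≢false refl ()

≢true⇒false : ∀ {b} → ¬ b ≡ true → b ≡ false
≢true⇒false {true}  h = ⊥-elim (h refl)
≢true⇒false {false} _ = refl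

≢false⇒true : ∀ {b} → ¬ b ≡ false → b ≡ true
≢false⇒true {true}  _ = refl
≢false⇒true {false} h = ⊥-elim (h refl)

⇔⇒≡ : ∀ {a b} → (a ≡ true → b ≡ true) → (b ≡ true → a ≡ true) → a ≡ b
⇔⇒≡ {true}  {b}     f g = sym (f refl)
⇔⇒≡ {false} {true}  f g = g refl
⇔⇒≡ {false} {false} f g = refl

does-true : ∀ {A : Set} (d : Dec A) → does d ≡ true → A
does-true (yes a) _ = a

does-false : ∀ {A : Set} (d : Dec A) → does d ≡ false → ¬ A
does-false (no ¬a) _ = ¬a

-- Sizes of Boolean subsets, as measures for well-founded recursion

count : ∀ {k} → (Fin k → Bool) → ℕ
count {zero}  f = 0
count {suc k} f with f zero
... | true  = suc (count (f ∘ suc))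
... | false = count (f ∘ suc)

count-mono : ∀ {k} (f g : Fin k → Bool) → (∀ i → Mem f i → Mem g i) → count f ≤ count g
count-mono {zero}  f g h = z≤n
count-mono {suc k} f g h with f zero in p | g zero in q
... | true  | true  = s≤s (count-mono (f ∘ suc) (g ∘ suc) (h ∘ suc))
... | true  | false = ⊥-elim (true≢false (h zero p) q)
... | false | true  = ℕ.m≤n⇒m≤1+n (count-mono (f ∘ suc) (g ∘ suc) (h ∘ suc))
... | false | false = count-mono (f ∘ suc) (g ∘ suc) (h ∘ suc)

count-strict : ∀ {k} (f g : Fin k → Bool) → (∀ i → Mem f i → Mem g i) →
  ∀ i → f i ≡ false → g i ≡ true → count f < count g
count-strict {suc k} f g h i fi gi with f zero in p | g zero in q
count-strict {suc k} f g h zero    fi gi | true  | _     = ⊥-elim (true≢false p fi)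
count-strict {suc k} f g h zero    fi gi | false | false = ⊥-elim (true≢false gi q)
count-strict {suc k} f g h zero    fi gi | false | true  = s≤s (count-mono (f ∘ suc) (g ∘ suc) (h ∘ suc))
count-strict {suc k} f g h (suc i) fi gi | true  | true  = s≤s (count-strict (f ∘ suc) (g ∘ suc) (h ∘ suc) i fi gi)
count-strict {suc k} f g h (suc i) fi gi | true  | false = ⊥-elim (true≢false (h zero p) q)
count-strict {suc k} f g h (suc i) fi gi | false | true  = ℕ.m≤n⇒m≤1+n (count-strict (f ∘ suc) (g ∘ suc) (h ∘ suc) i fi gi)
count-strict {suc k} f g h (suc i) fi gi | false | false = count-strict (f ∘ suc) (g ∘ suc) (h ∘ suc) i fi gi

-- Twins in graphs without induced P₄

Three : ∀ {k} → (Fin k → Bool) → Set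
Three S = ∃[ a ] ∃[ b ] ∃[ c ] (a ≢ b × a ≢ c × b ≢ c × Mem S a × Mem S b × Mem S c)

third : ∀ {k} {S : Fin k → Bool} → Three S → ∀ x y → ∃[ z ] (Mem S z × z ≢ x × z ≢ y)
third (a , b , c , a≢b , a≢c , b≢c , Sa , Sb , Sc) x y with a ≟ x | a ≟ y | b ≟ x | b ≟ y
... | no p     | no q     | _        | _        = a , Sa , p , q
... | yes refl | _        | _        | no q     = b , Sb , (a≢b ∘ sym) , q
... | yes refl | _        | _        | yes refl = c , Sc , (a≢c ∘ sym) , (b≢c ∘ sym)
... | no _     | yes refl | no p     | _        = b , Sb , p , (a≢b ∘ sym)
... | no _     | yes refl | yes refl | _        = c , Sc , (b≢c ∘ sym) , (a≢c ∘ sym)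

module _ {k : ℕ} (e : Fin k → Fin k → Bool) (e-sym : ∀ x y → e x y ≡ e y x) where

  P₄FreeOn : (Fin k → Bool) → Set
  P₄FreeOn S = ∀ a b c d → Mem S a → Mem S b → Mem S c → Mem S d →
    e a b ≡ true → e b c ≡ true → e c d ≡ true →
    e a c ≡ false → e a d ≡ false → e b d ≡ false → ⊥

  -- P₄ is self-complementary, so it is excluded in either colour.
  noP₄ : ∀ {S} → P₄FreeOn S → ∀ c {p q r s} → Mem S p → Mem S q → Mem S r → Mem S s →
    e p q ≡ not c → e q r ≡ not c → e r s ≡ not c →
    e p r ≡ c → e p s ≡ c → e q s ≡ c → ⊥
  noP₄ free false {p} {q} {r} {s} Sp Sq Sr Ss pq qr rs pr ps qs =
    free p q r s Sp Sq Sr Ss pq qr rs pr ps qs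
  noP₄ free true {p} {q} {r} {s} Sp Sq Sr Ss pq qr rs pr ps qs =
    free q s p r Sq Ss Sp Sr qs (trans (e-sym s p) ps) pr (trans (e-sym q p) pq) qr (trans (e-sym s r) rs)

  -- With `colour` false the graph on `S` is disconnected, with `colour` true its complement is. One
  -- record for both lets each argument below serve the graph and its complement at once.
  record Cut (S : Fin k → Bool) : Set where
    constructor cut
    field
      P        : Fin k → Bool
      colour   : Bool
      {l r}    : Fin k
      Sl       : Mem S l
      Pl       : P l ≡ true
      Sr       : Mem S r
      Pr       : P r ≡ false
      monochrome : ∀ x y → Mem S x → Mem S y → P x ≡ true → P y ≡ false → e x y ≡ colour

  cutBy : ∀ {S} {Q : Fin k → Set} (Q? : ∀ x → Dec (Q x)) c {l r} → Mem S l → Q l → Mem S r → ¬ Q r →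
    (∀ x y → Mem S x → Mem S y → Q x → ¬ Q y → e x y ≡ c) → Cut S
  cutBy Q? c Sl Ql Sr Qr mono =
    cut (does ∘ Q?) c Sl (dec-true (Q? _) Ql) Sr (dec-false (Q? _) Qr)
      (λ x y Sx Sy Px Py → mono x y Sx Sy (does-true (Q? x) Px) (does-false (Q? y) Py))

  remove : Fin k → (Fin k → Bool) → Fin k → Bool
  remove v S x = S x ∧ does (¬? (x ≟ v))

  remove-⊆ : ∀ v S x → Mem (remove v S) x → Mem S x × x ≢ v
  remove-⊆ v S x m with S x
  ... | true = refl , does-true (¬? (x ≟ v)) m

  remove-∈ : ∀ v S x → Mem S x → x ≢ v → Mem (remove v S) x
  remove-∈ v S x m x≢v rewrite m = dec-true (¬? (x ≟ v)) x≢v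

  remove-self : ∀ v S → remove v S v ≡ false
  remove-self v S = ≢true⇒false (λ m → proj₂ (remove-⊆ v S v m) refl)

  -- One of the following is a side of a monochromatic cut of S: {v}, a side of the given cut of
  -- S - v, or the vertices on such a side that v sees in the colour of the cut. Otherwise there
  -- is a P₄ through v, in that colour or the other.
  module _ {S} (free : P₄FreeOn S) (v : Fin k) (Sv : Mem S v) (C : Cut (remove v S)) where
    open Cut C

    private
      mono-side : ∀ b x y → Mem S x → Mem S y → x ≢ v → y ≢ v → P x ≡ b → P y ≡ not b → e x y ≡ colour
      mono-side true x y Sx Sy x≢v y≢v = monochrome x y (remove-∈ v S x Sx x≢v) (remove-∈ v S y Sy y≢v)
      mono-side false x y Sx Sy x≢v y≢v Px Py =
        trans (e-sym x y) (monochrome y x (remove-∈ v S y Sy y≢v) (remove-∈ v S x Sx x≢v) Py Px)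

      Side : Bool → Fin k → Set
      Side b x = Mem S x × x ≢ v × P x ≡ b

      side? : ∀ b x → Dec (Side b x)
      side? b x = (S x Bool.≟ true) ×-dec (¬? (x ≟ v)) ×-dec (P x Bool.≟ b)

      inhabited : ∀ b → ∃[ x ] Side b x
      inhabited true  = l , let m , n = remove-⊆ v S l Sl in m , n , Pl
      inhabited false = r , let m , n = remove-⊆ v S r Sr in m , n , Pr

      Near Far : Bool → Fin k → Set
      Near b x = Side b x × e x v ≡ not colour
      Far  b x = Side b x × e x v ≡ colour

      near? : ∀ b x → Dec (Near b x)
      near? b x = side? b x ×-dec (e x v Bool.≟ not colour)

      far? : ∀ b x → Dec (Far b x)
      far? b x = side? b x ×-dec (e x v Bool.≟ colour)

      v≢side : ∀ {b} → ¬ Side b v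
      v≢side (_ , v≢v , _) = v≢v refl

      Bad : Bool → Fin k → Fin k → Set
      Bad b x y = Far b x × Near b y × e x y ≡ not colour

      bad? : ∀ b → Dec (∃[ x ] ∃[ y ] Bad b x y)
      bad? b = any? λ x → any? λ y → far? b x ×-dec near? b y ×-dec (e x y Bool.≟ not colour)

      -- A near vertex `z` on the other side would complete `x`, `y`, `v`, `z` to an induced P₄ in
      -- the colour `not colour`. So `v` sees that whole side in `colour`, and the side can be cut
      -- off from the rest together with `v`.
      whenBad : ∀ b → (∃[ x ] ∃[ y ] Bad b x y) → Cut S
      whenBad b (x , y , ((Sx , x≢v , Px) , xv) , ((Sy , y≢v , Py) , yv) , xy) with any? (near? (not b))
      ... | yes (z , (Sz , z≢v , Pz) , zv) =
            ⊥-elim (noP₄ free colour Sx Sy Sv Sz xy yv (trans (e-sym v z) zv) xv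
              (mono-side b x z Sx Sz x≢v z≢v Px Pz) (mono-side b y z Sy Sz y≢v z≢v Py Pz))
      ... | no none = cutBy (side? (not b)) colour (proj₁ (proj₂ w)) (proj₂ w) Sv v≢side mono
        where
        w = inhabited (not b)
        mono : ∀ x y → Mem S x → Mem S y → Side (not b) x → ¬ Side (not b) y → e x y ≡ colour
        mono x y Sx Sy sx ¬sy with y ≟ v
        ... | yes refl with e x y Bool.≟ colour
        ...   | yes q = q
        ...   | no ¬q = ⊥-elim (none (x , sx , Bool.¬-not ¬q))
        mono x y Sx Sy (_ , x≢v , Px) ¬sy | no y≢v =
          mono-side (not b) x y Sx Sy x≢v y≢v Px (Bool.¬-not (λ q → ¬sy (Sy , y≢v , q)))

      -- Far vertices see `v` in `colour` by definition, the other side by the given cut, and the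
      -- rest of their own side because there is no bad pair.
      whenFar : ∀ b → ¬ (∃[ x ] ∃[ y ] Bad b x y) → (∃[ x ] Far b x) → Cut S
      whenFar b good (w , fw) = cutBy (far? b) colour (proj₁ (proj₁ fw)) fw Sv (v≢side ∘ proj₁) mono
        where
        mono : ∀ x y → Mem S x → Mem S y → Far b x → ¬ Far b y → e x y ≡ colour
        mono x y Sx Sy fx@((_ , x≢v , Px) , xv) ¬fy with y ≟ v
        ... | yes refl = xv
        ... | no y≢v with P y Bool.≟ b
        ...   | no ¬q = mono-side b x y Sx Sy x≢v y≢v Px (Bool.¬-not ¬q)
        ...   | yes Py with e x y Bool.≟ colour
        ...     | yes q = q
        ...     | no ¬q = ⊥-elim (good (x , y , fx ,
                    ((Sy , y≢v , Py) , Bool.¬-not (λ q → ¬fy ((Sy , y≢v , Py) , q))) ,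
                    Bool.¬-not ¬q))

      whenNear : (∀ b → ¬ (∃[ x ] Far b x)) → Cut S
      whenNear near = cutBy (_≟ v) (not colour) Sv refl (proj₁ (proj₂ w)) (proj₁ (proj₂ (proj₂ w))) mono
        where
        w = inhabited true
        mono : ∀ x y → Mem S x → Mem S y → x ≡ v → y ≢ v → e x y ≡ not colour
        mono x y Sx Sy refl y≢v = trans (e-sym x y)
          (Bool.¬-not (λ q → near (P y) (y , (Sy , y≢v , refl) , q)))

    extendCut : Cut S
    extendCut with bad? true | bad? false
    ... | yes bd | _      = whenBad true bd
    ... | no _   | yes bd = whenBad false bd
    ... | no g₁  | no g₂ with any? (far? true) | any? (far? false)
    ...   | yes f | _     = whenFar true g₁ f
    ...   | no _  | yes f = whenFar false g₂ f
    ...   | no n₁ | no n₂ = whenNear (λ { true → n₁ ; false → n₂ })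

  -- The classical fact that a P₄-free graph on at least two vertices is disconnected or has a
  -- disconnected complement. The induction deletes `u` and puts it back with `extendCut`; on two
  -- vertices the colour of the only pair is the colour of the cut.
  hasCut : ∀ S → P₄FreeOn S → ∀ {u w} → Mem S u → Mem S w → u ≢ w → Cut S
  hasCut S free = go S free (<-wellFounded (count S))
    where
    go : ∀ S → P₄FreeOn S → Acc _<_ (count S) → ∀ {u w} → Mem S u → Mem S w → u ≢ w → Cut S
    go S free (acc rs) {u} {w} Su Sw u≢w
      with any? (λ z → (S z Bool.≟ true) ×-dec ¬? (z ≟ u) ×-dec ¬? (z ≟ w))
    ... | yes (z , Sz , z≢u , z≢w) = extendCut free u Su
          (go (remove u S) free′ (rs smaller) (remove-∈ u S w Sw (u≢w ∘ sym)) (remove-∈ u S z Sz z≢u) (z≢w ∘ sym))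
      where
      ⊆S : ∀ x → Mem (remove u S) x → Mem S x
      ⊆S x = proj₁ ∘ remove-⊆ u S x
      free′ : P₄FreeOn (remove u S)
      free′ a b c d Sa Sb Sc Sd = free a b c d (⊆S a Sa) (⊆S b Sb) (⊆S c Sc) (⊆S d Sd)
      smaller : count (remove u S) < count S
      smaller = count-strict (remove u S) S ⊆S u (remove-self u S) Su
    ... | no none = cutBy (_≟ u) (e u w) Su refl Sw (u≢w ∘ sym) mono
      where
      mono : ∀ x y → Mem S x → Mem S y → x ≡ u → y ≢ u → e x y ≡ e u w
      mono x y Sx Sy refl y≢u with y ≟ w
      ... | yes refl = refl
      ... | no y≢w = ⊥-elim (none (y , Sy , y≢u , y≢w))

  Twins : (Fin k → Bool) → Fin k → Fin k → Set
  Twins S x y = Mem S x × Mem S y × x ≢ y × (∀ z → Mem S z → z ≢ x → z ≢ y → e x z ≡ e y z)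

  -- Each vertex beyond a cut sees the whole of one side in a single colour, so twins found inside a
  -- side remain twins in `S`. If both sides are singletons, these two vertices are all of `S` and
  -- are twins trivially.
  hasTwins : ∀ S → P₄FreeOn S → ∀ {u w} → Mem S u → Mem S w → u ≢ w → ∃[ x ] ∃[ y ] Twins S x y
  hasTwins S free = go S free (<-wellFounded (count S))
    where
    go : ∀ S → P₄FreeOn S → Acc _<_ (count S) → ∀ {u w} → Mem S u → Mem S w → u ≢ w → ∃[ x ] ∃[ y ] Twins S x y
    go S free (acc rs) Su Sw u≢w = result
      where
      open Cut (hasCut S free Su Sw u≢w)
      Part : Bool → Fin k → Bool
      Part b x = S x ∧ does (P x Bool.≟ b)
      part-⊆ : ∀ b x → Mem (Part b) x → Mem S x × P x ≡ b
      part-⊆ b x m with S x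
      ... | true = refl , does-true (P x Bool.≟ b) m
      part-∈ : ∀ b x → Mem S x → P x ≡ b → Mem (Part b) x
      part-∈ b x m q rewrite m = dec-true (P x Bool.≟ b) q
      coloured : ∀ b x z → Mem S x → Mem S z → P x ≡ b → P z ≡ not b → e x z ≡ colour
      coloured true  x z Sx Sz = monochrome x z Sx Sz
      coloured false x z Sx Sz Px Pz = trans (e-sym x z) (monochrome z x Sz Sx Pz Px)
      recurse : ∀ b {p q o} → Mem S p → Mem S q → P p ≡ b → P q ≡ b → p ≢ q →
        Mem S o → P o ≡ not b → ∃[ x ] ∃[ y ] Twins S x y
      recurse b {p} {q} {o} Sp Sq Pp Pq p≢q So Po
        with x , y , Tx , Ty , x≢y , tw ← go (Part b)
          (λ a b′ c d Sa Sb Sc Sd → free a b′ c d (proj₁ (part-⊆ b a Sa)) (proj₁ (part-⊆ b b′ Sb))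
             (proj₁ (part-⊆ b c Sc)) (proj₁ (part-⊆ b d Sd)))
          (rs (count-strict (Part b) S (λ x → proj₁ ∘ part-⊆ b x) o
            (≢true⇒false (λ m → Bool.not-¬ {b} refl (trans (sym (proj₂ (part-⊆ b o m))) Po))) So))
          (part-∈ b p Sp Pp) (part-∈ b q Sq Pq) p≢q
        = x , y , Sx , Sy , x≢y , twins
        where
        Sx = proj₁ (part-⊆ b x Tx)
        Sy = proj₁ (part-⊆ b y Ty)
        twins : ∀ z → Mem S z → z ≢ x → z ≢ y → e x z ≡ e y z
        twins z Sz z≢x z≢y with P z Bool.≟ b
        ... | yes Pz = tw z (part-∈ b z Sz Pz) z≢x z≢y
        ... | no ¬Pz = trans (coloured b x z Sx Sz (proj₂ (part-⊆ b x Tx)) Pz)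
                             (sym (coloured b y z Sy Sz (proj₂ (part-⊆ b y Ty)) Pz))
          where Pz = Bool.¬-not ¬Pz
      another : ∀ b o → Dec (∃[ x ] (Mem S x × P x ≡ b × x ≢ o))
      another b o = any? λ x → (S x Bool.≟ true) ×-dec (P x Bool.≟ b) ×-dec ¬? (x ≟ o)
      result : ∃[ x ] ∃[ y ] Twins S x y
      result with another true l | another false r
      ... | yes (p , Sp , Pp , p≢l) | _ = recurse true Sp Sl Pp Pl p≢l Sr Pr
      ... | no _ | yes (p , Sp , Pp , p≢r) = recurse false Sp Sr Pp Pr p≢r Sl Pl
      ... | no n₁ | no n₂ = l , r , Sl , Sr , (λ q → true≢false Pl (trans (cong P q) Pr)) , none
        where
        none : ∀ z → Mem S z → z ≢ l → z ≢ r → e l z ≡ e r z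
        none z Sz z≢l z≢r with P z in q
        ... | true  = ⊥-elim (n₁ (z , Sz , q , z≢l))
        ... | false = ⊥-elim (n₂ (z , Sz , q , z≢r))

  -- A split needs four vertices, so every graph on three vertices is prime. This condition leaves
  -- only the path and the triangle among them, which are a star and a clique.
  NoIsolated : (Fin k → Bool) → Set
  NoIsolated S = ∀ u → Mem S u → ∃[ w ] (Mem S w × w ≢ u × e u w ≡ true)

  -- A pair of twins against the rest is a split as soon as the rest has two vertices.
  primeDegenerate : (∀ x → e x x ≡ false) → ∀ S → P₄FreeOn S → NoIsolated S → Three S → PrimeOn S e → DegenerateOn S e
  primeDegenerate e-irr S free noIso three@(a , b , _ , a≢b , _ , _ , Sa , Sb , _) prime
    with x , y , Sx , Sy , x≢y , tw ← hasTwins S free Sa Sb a≢b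
    with z , Sz , z≢x , z≢y ← third {S = S} three x y
    with any? (λ w → (S w Bool.≟ true) ×-dec ¬? (w ≟ x) ×-dec ¬? (w ≟ y) ×-dec ¬? (w ≟ z))
  ... | yes (w , Sw , w≢x , w≢y , w≢z) = ⊥-elim (prime (does ∘ pair?)
        ( (x , y , x≢y , Sx , dec-true (pair? x) (inj₁ refl) , Sy , dec-true (pair? y) (inj₂ refl))
        , (w , z , w≢z , Sw , dec-false (pair? w) [ w≢x , w≢y ]′ , Sz , dec-false (pair? z) [ z≢x , z≢y ]′)
        , joined))
    where
    pair? : ∀ v → Dec (v ≡ x ⊎ v ≡ y)
    pair? v = (v ≟ x) ⊎-dec (v ≟ y)
    same : ∀ {u v v′} → Mem S u → ¬ (u ≡ x ⊎ u ≡ y) → v ≡ x ⊎ v ≡ y → v′ ≡ x ⊎ v′ ≡ y → e u v′ ≡ true → e u v ≡ true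
    same {u} Su out p q uv′ with p | q
    ... | inj₁ refl | inj₁ refl = uv′
    ... | inj₂ refl | inj₂ refl = uv′
    ... | inj₁ refl | inj₂ refl = trans (e-sym u x) (trans (tw u Su (out ∘ inj₁) (out ∘ inj₂)) (trans (e-sym y u) uv′))
    ... | inj₂ refl | inj₁ refl = trans (e-sym u y) (trans (sym (tw u Su (out ∘ inj₁) (out ∘ inj₂))) (trans (e-sym x u) uv′))
    joined : ∀ u v → Mem S u → does (pair? u) ≡ false → Mem S v → does (pair? v) ≡ true
      → (∃[ v′ ] (Mem S v′ × does (pair? v′) ≡ true × e u v′ ≡ true))
      → (∃[ u′ ] (Mem S u′ × does (pair? u′) ≡ false × e v u′ ≡ true)) → e u v ≡ true
    joined u v Su Pu Sv Pv (v′ , Sv′ , Pv′ , uv′) _ =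
      same Su (does-false (pair? u) Pu) (does-true (pair? v) Pv) (does-true (pair? v′) Pv′) uv′
  ... | no none = degenerate
    where
    cases : ∀ u → Mem S u → u ≡ x ⊎ u ≡ y ⊎ u ≡ z
    cases u Su with u ≟ x | u ≟ y | u ≟ z
    ... | yes p | _     | _     = inj₁ p
    ... | no _  | yes p | _     = inj₂ (inj₁ p)
    ... | no _  | no _  | yes p = inj₂ (inj₂ p)
    ... | no p  | no q  | no r  = ⊥-elim (none (u , Su , p , q , r))
    xz : e x z ≡ true
    xz with w , Sw , w≢z , zw ← noIso z Sz with cases w Sw
    ... | inj₁ refl        = trans (e-sym x z) zw
    ... | inj₂ (inj₁ refl) = trans (tw z Sz z≢x z≢y) (trans (e-sym y z) zw)
    ... | inj₂ (inj₂ refl) = ⊥-elim (w≢z refl)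
    yz : e y z ≡ true
    yz = trans (sym (tw z Sz z≢x z≢y)) xz
    degenerate : DegenerateOn S e
    degenerate with e x y in xy
    ... | true = inj₁ clique
      where
      clique : IsCliqueOn S e
      clique u w Su Sw u≢w with cases u Su | cases w Sw
      ... | inj₁ refl        | inj₁ refl        = ⊥-elim (u≢w refl)
      ... | inj₁ refl        | inj₂ (inj₁ refl) = xy
      ... | inj₁ refl        | inj₂ (inj₂ refl) = xz
      ... | inj₂ (inj₁ refl) | inj₁ refl        = trans (e-sym y x) xy
      ... | inj₂ (inj₁ refl) | inj₂ (inj₁ refl) = ⊥-elim (u≢w refl)
      ... | inj₂ (inj₁ refl) | inj₂ (inj₂ refl) = yz
      ... | inj₂ (inj₂ refl) | inj₁ refl        = trans (e-sym z x) xz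
      ... | inj₂ (inj₂ refl) | inj₂ (inj₁ refl) = trans (e-sym z y) yz
      ... | inj₂ (inj₂ refl) | inj₂ (inj₂ refl) = ⊥-elim (u≢w refl)
    ... | false = inj₂ (z , Sz , centre , leaves)
      where
      centre : ∀ u → Mem S u → u ≢ z → e z u ≡ true
      centre u Su u≢z with cases u Su
      ... | inj₁ refl        = trans (e-sym z x) xz
      ... | inj₂ (inj₁ refl) = trans (e-sym z y) yz
      ... | inj₂ (inj₂ refl) = ⊥-elim (u≢z refl)
      leaves : ∀ u w → Mem S u → Mem S w → u ≢ z → w ≢ z → e u w ≡ false
      leaves u w Su Sw u≢z w≢z with cases u Su | cases w Sw
      ... | inj₁ refl        | inj₁ refl        = e-irr u
      ... | inj₁ refl        | inj₂ (inj₁ refl) = xy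
      ... | inj₂ (inj₁ refl) | inj₁ refl        = trans (e-sym y x) xy
      ... | inj₂ (inj₁ refl) | inj₂ (inj₁ refl) = e-irr u
      ... | inj₂ (inj₂ refl) | _                = ⊥-elim (u≢z refl)
      ... | inj₁ refl        | inj₂ (inj₂ refl) = ⊥-elim (w≢z refl)
      ... | inj₂ (inj₁ refl) | inj₂ (inj₂ refl) = ⊥-elim (w≢z refl)

-- Trees

module Tree {t : ℕ} (E : Fin t → Fin t → Bool)
  (E-sym : ∀ a b → E a b ≡ E b a) (E-irr : ∀ a → E a a ≡ false)
  (E-conn : ∀ a b → ∃[ ps ] Path E a b ps)
  (E-acyc : ∀ a b ps qs → Path E a b ps → Path E a b qs → ps ≡ qs) where

  swapE : ∀ {a b} → E a b ≡ true → E b a ≡ true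
  swapE {a} {b} h = trans (E-sym b a) h

  E⇒≢ : ∀ {a b} → E a b ≡ true → a ≢ b
  E⇒≢ {a} h refl = true≢false h (E-irr a)

  private
    path : Fin t → Fin t → List (Fin t)
    path a b = proj₁ (E-conn a b)

    second : Fin t → List (Fin t) → Fin t
    second d []          = d
    second d (_ ∷ [])    = d
    second d (_ ∷ y ∷ _) = y

    second-step : ∀ {d a x y ps} → Walk E x y ps → second d (a ∷ ps) ≡ x
    second-step here       = refl
    second-step (step _ _) = refl

  -- The neighbour of p in the direction of x; dir p p = p.
  dir : Fin t → Fin t → Fin t
  dir p x = second p (path p x)

  dist : Fin t → Fin t → ℕ
  dist p x = length (path p x)

  private
    path-unique : ∀ {a x ps} → Path E a x ps → path a x ≡ ps
    path-unique {a} {x} {ps} h = E-acyc a x (path a x) ps (proj₂ (E-conn a x)) h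

    path-cons : ∀ {a y x ps} → E a y ≡ true → Path E y x ps → All (a ≢_) ps →
      path a x ≡ a ∷ path y x × dir a x ≡ y
    path-cons {a} e (w , u) fresh =
      trans eq (cong (a ∷_) (sym (path-unique (w , u)))) , trans (cong (second a) eq) (second-step w)
      where eq = path-unique (step e w , fresh ∷ u)

    path-≢ : ∀ {a x} → a ≢ x → E a (dir a x) ≡ true × path a x ≡ a ∷ path (dir a x) x
    path-≢ {a} {x} a≢x with E-conn a x in eq
    ... | _ , here , _ = ⊥-elim (a≢x refl)
    ... | _ , step {x = y} {ps = ps} e w , fresh ∷ u =
          subst (λ q → E a q ≡ true × a ∷ ps ≡ a ∷ path q x) (sym (second-step w))
            (e , cong (a ∷_) (sym (path-unique (w , u))))

    suffix : ∀ {p y x ps} → Walk E y x ps → Unique ps → p ∈ ps →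
      ∃[ qs ] (Path E p x qs × (∀ {Q : Fin t → Set} → All Q ps → All Q qs))
    suffix w u (here refl) with w
    ... | here     = _ , (w , u) , λ h → h
    ... | step _ _ = _ , (w , u) , λ h → h
    suffix (step e w) (_ ∷ u) (there m) with qs , q , sub ← suffix w u m = qs , q , λ { (_ ∷ h) → sub h }

  dir-refl : ∀ a → dir a a ≡ a
  dir-refl a = cong (second a) (path-unique (here , [] ∷ []))

  dir-E : ∀ {a x} → a ≢ x → E a (dir a x) ≡ true
  dir-E = proj₁ ∘ path-≢

  dist-dir : ∀ {a x} → a ≢ x → dist (dir a x) x < dist a x
  dist-dir a≢x = subst (λ ps → dist (dir _ _) _ < length ps) (sym (proj₂ (path-≢ a≢x))) ℕ.≤-refl

  dir-step : ∀ {a y x ps} → E a y ≡ true → Path E y x ps → All (a ≢_) ps → dir a x ≡ y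
  dir-step e pth fresh = proj₂ (path-cons e pth fresh)

  -- If the path from `q` to `x` avoids `p`, prefixing `p` gives the path from `p`. If it meets `p`,
  -- its tail from `p` on avoids `q`, and prefixing `q` gives the path from `q`.
  side : ∀ {p q} → E p q ≡ true → ∀ x → dir p x ≡ q ⊎ dir q x ≡ p
  side {p} {q} e x = go (proj₂ (E-conn q x))
    where
    go : ∀ {ps} → Path E q x ps → dir p x ≡ q ⊎ dir q x ≡ p
    go {ps} (w , u) with Any.any? (p ≟_) ps
    ... | no p∉ = inj₁ (proj₂ (path-cons e (w , u) (¬Any⇒All¬ _ p∉)))
    ... | yes p∈ with w | u | p∈
    ...   | here | _ | here refl = ⊥-elim (E⇒≢ e refl)
    ...   | step _ _ | _ | here refl = ⊥-elim (E⇒≢ e refl)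
    ...   | step _ w′ | fresh ∷ u′ | there m with qs , pth , sub ← suffix w′ u′ m =
              inj₂ (proj₂ (path-cons (swapE e) pth (sub fresh)))

  -- A step along `dir` strictly decreases the distance to `x`, which cannot happen both from `p` to
  -- `q` and from `q` to `p`.
  ¬both-sides : ∀ {p q} → E p q ≡ true → ∀ {x} → dir p x ≡ q → dir q x ≡ p → ⊥
  ¬both-sides {p} {q} e {x} pq qp = ℕ.<-asym
    (subst (λ r → dist r x < dist p x) pq (dist-dir λ { refl → E⇒≢ e (trans (sym (dir-refl p)) pq) }))
    (subst (λ r → dist r x < dist q x) qp (dist-dir λ { refl → E⇒≢ (swapE e) (trans (sym (dir-refl q)) qp) }))

  dir-adj : ∀ {p q} → E p q ≡ true → dir p q ≡ q
  dir-adj {p} {q} e with side e q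
  ... | inj₁ h = h
  ... | inj₂ h = ⊥-elim (E⇒≢ e (trans (sym h) (dir-refl q)))

  other-side : ∀ {p q} → E p q ≡ true → ∀ {x} → dir p x ≢ q → dir q x ≡ p
  other-side e {x} h with side e x
  ... | inj₁ k = ⊥-elim (h k)
  ... | inj₂ k = k

  -- The vertex `a` lies on the path from `v` to `x`. The induction moves `a` one step towards `v`:
  -- from the new vertex, both `x` and the old `a` lie in the direction of the old `a`.
  dir-between : ∀ {a v x} → a ≢ v → dir a v ≢ dir a x → dir v x ≡ dir v a
  dir-between {a} {v} {x} = go a x (<-wellFounded (dist a v))
    where
    go : ∀ a x → Acc _<_ (dist a v) → a ≢ v → dir a v ≢ dir a x → dir v x ≡ dir v a
    go a x (acc rs) a≢v h with dir a v ≟ v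
    ... | yes q = trans (other-side e (subst (_≢_ (dir a x)) q (h ∘ sym))) (sym (dir-adj (swapE e)))
      where
      e : E a v ≡ true
      e = subst (λ u → E a u ≡ true) q (dir-E a≢v)
    ... | no u≢v = trans (step-to x ux) (sym (step-to a (dir-adj (swapE e))))
      where
      u = dir a v
      e : E a u ≡ true
      e = dir-E a≢v
      ux : dir u x ≡ a
      ux = other-side e (h ∘ sym)
      step-to : ∀ y → dir u y ≡ a → dir v y ≡ dir v u
      step-to y uy = go u y (rs (dist-dir a≢v)) u≢v
        (λ q → ¬both-sides e refl (trans q uy))

  dir-same : ∀ {l m v} → E l m ≡ true → v ≢ l → v ≢ m → dir v l ≡ dir v m
  dir-same {l} {m} {v} e v≢l v≢m with dir m v ≟ l
  ... | no h = dir-between (v≢m ∘ sym) (λ q → h (trans q (dir-adj (swapE e))))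
  ... | yes h = sym (dir-between (v≢l ∘ sym) (λ q → ¬both-sides e (trans q (dir-adj e)) h))

  branch : Fin t → Fin t → Fin t → Bool
  branch p q x = does (dir p x ≟ q)

  branch-shrinks : ∀ {p q r} → E p q ≡ true → E q r ≡ true → r ≢ p → count (branch q r) < count (branch p q)
  branch-shrinks {p} {q} {r} pq qr r≢p = count-strict (branch q r) (branch p q) inside q
    (dec-false (dir q q ≟ r) (λ h → E⇒≢ qr (trans (sym (dir-refl q)) h)))
    (dec-true (dir p q ≟ q) (dir-adj pq))
    where
    inside : ∀ x → Mem (branch q r) x → Mem (branch p q) x
    inside x m = dec-true (dir p x ≟ q)
      (other-side (swapE pq) (λ h → r≢p (trans (sym (does-true (dir q x ≟ r) m)) h)))

-- Accessibility in graph-labelled trees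

module Accessibility {n : ℕ} (T : GLT n) where
  open GLT T public
  open Tree E E-sym E-irr E-conn E-acyc public

  -- Accessibility without paths: the vertices that meet the three conditions are the interior
  -- vertices of the path from `l` to `u`, and the two directions are the path edges at them.
  Linked : Fin t → Fin t → Set
  Linked l u = ∀ v → v ≢ l → v ≢ u → dir v l ≢ dir v u → lab v (dir v l) (dir v u) ≡ true

  private
    walk-head : ∀ {a b ps} → Walk E a b ps → ∃[ qs ] ps ≡ a ∷ qs
    walk-head here       = _ , refl
    walk-head (step _ _) = _ , refl

    more-walk : ∀ {l m r u ps} → Walk E r u ps → lab m l r ≡ true → AccPath T (m ∷ ps) → AccPath T (l ∷ m ∷ ps)
    more-walk w lb ap with walk-head w
    ... | _ , refl = more lb ap

    walk-first : ∀ {a b ps} {Q : Fin t → Set} → Walk E a b ps → All Q ps → Q a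
    walk-first here       (h ∷ _) = h
    walk-first (step _ _) (h ∷ _) = h

    walk-last : ∀ {a b ps} {Q : Fin t → Set} → Walk E a b ps → All Q ps → Q b
    walk-last here       (h ∷ _) = h
    walk-last (step _ w) (_ ∷ h) = walk-last w h

  accPath⇒linked : ∀ {l u ps} → Path E l u ps → AccPath T ps → Linked l u
  accPath⇒linked (here , _) _ v _ _ h = ⊥-elim (h refl)
  accPath⇒linked (step e here , _) _ v v≢l v≢u h = ⊥-elim (h (dir-same e v≢l v≢u))
  accPath⇒linked (step {x = m} e (step e′ w) , (_ ∷ f) ∷ (f′ ∷ u′)) ap v v≢l v≢u h
    with walk-head w | ap | v ≟ m
  ... | _ , refl | more lb _ | yes refl = subst₂ (λ a b → lab v a b ≡ true)
          (sym (dir-adj (swapE e))) (sym (dir-step e′ (w , u′) f′)) lb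
  ... | _ , refl | more _ ap′ | no v≢m = subst (λ a → lab v a (dir v _) ≡ true) (sym (dir-same e v≢l v≢m))
          (accPath⇒linked (step e′ w , f′ ∷ u′) ap′ v v≢m v≢u (λ q → h (trans (dir-same e v≢l v≢m) q)))

  linked⇒accPath : ∀ {l u ps} → Path E l u ps → Linked l u → AccPath T ps
  linked⇒accPath (here , _) lk = one
  linked⇒accPath (step e here , _) lk = two
  linked⇒accPath {l} {u} (step {x = m} e (step {x = r} e′ w) , (l≢m ∷ f) ∷ (f′ ∷ uq)) lk = more-walk w
      (subst₂ (λ a b → lab m a b ≡ true) ml mu
        (lk m (l≢m ∘ sym) (walk-last w f′) (λ q → walk-first w f (trans (sym ml) (trans q mu)))))
      (linked⇒accPath (step e′ w , f′ ∷ uq) lk′)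
    where
    mu : dir m u ≡ r
    mu = dir-step e′ (w , uq) f′
    ml : dir m l ≡ l
    ml = dir-adj (swapE e)
    lk′ : Linked m u
    lk′ v v≢m v≢u h = subst (λ a → lab v a (dir v u) ≡ true) same (lk v v≢l v≢u (λ q → h (trans (sym same) q)))
      where
      v≢l : v ≢ l
      v≢l refl = h (trans (dir-adj e) (sym (dir-step e (step e′ w , f′ ∷ uq) (l≢m ∷ f))))
      same : dir v l ≡ dir v m
      same = dir-same e v≢l v≢m

  accessible⇔linked : ∀ l u → Accessible T l u ⇔ Linked l u
  accessible⇔linked l u = mk⇔
    (λ { (ps , pth , ap) → accPath⇒linked pth ap })
    (λ lk → let ps , pth = E-conn l u in ps , pth , linked⇒accPath pth lk)

  linked-sym : ∀ {a b} → Linked a b → Linked b a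
  linked-sym lk v v≢b v≢a h = trans (lab-sym v _ _) (lk v v≢a v≢b (h ∘ sym))

  linked-edge : ∀ {a b} → E a b ≡ true → Linked a b
  linked-edge e v v≢a v≢b h = ⊥-elim (h (dir-same e v≢a v≢b))

  -- An interior vertex `w` of the path from `v` to `x` sees `y` as it sees `v`, so the condition
  -- required at `w` is the one it already meets on the path from `x` to `y`.
  linked-part : ∀ {v x y} → v ≢ x → v ≢ y → dir v x ≢ dir v y → Linked x y → Linked v x
  linked-part {v} {x} {y} v≢x v≢y h lk w w≢v w≢x k =
    trans (lab-sym w _ _) (subst (λ a → lab w (dir w x) a ≡ true) wy
      (lk w w≢x (λ { refl → vw≢vy refl }) (λ q → k (trans (sym wy) (sym q)))))
    where
    vw≡vx : dir v w ≡ dir v x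
    vw≡vx with dir v w ≟ dir v x
    ... | yes q = q
    ... | no q  = ⊥-elim (k (sym (dir-between (w≢v ∘ sym) q)))
    vw≢vy : dir v w ≢ dir v y
    vw≢vy q = h (trans (sym vw≡vx) q)
    wy : dir w y ≡ dir w v
    wy = dir-between (w≢v ∘ sym) vw≢vy

  linked-lab : ∀ {v x y} → v ≢ x → v ≢ y → dir v x ≢ dir v y → Linked x y → lab v (dir v x) (dir v y) ≡ true
  linked-lab v≢x v≢y h lk = lk _ v≢x v≢y h

  -- The vertex `v` lies on the path from `x` to `y`. Any other interior vertex lies on one of the
  -- two halves and sees the far end as it sees `v`.
  linked-join : ∀ {v x y} → lab v (dir v x) (dir v y) ≡ true → Linked v x → Linked v y →
    dir v x ≢ dir v y → Linked x y
  linked-join {v} {x} {y} lb lx ly h w w≢x w≢y k with w ≟ v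
  ... | yes refl = lb
  ... | no w≢v with dir v w ≟ dir v x
  ...   | yes q = trans (lab-sym w _ _) (subst (λ a → lab w a (dir w x) ≡ true) (sym wy)
            (lx w w≢v w≢x (λ r → k (trans (sym r) (sym wy)))))
    where
    wy : dir w y ≡ dir w v
    wy = dir-between (w≢v ∘ sym) (λ r → h (trans (sym q) r))
  ...   | no q = subst (λ a → lab w a (dir w y) ≡ true) (sym wx)
            (ly w w≢v w≢y (λ r → k (trans wx r)))
    where
    wx : dir w x ≡ dir w v
    wx = dir-between (w≢v ∘ sym) q

  abstract
    isLeaf? : ∀ v → Dec (IsLeaf E v)
    isLeaf? v = all? λ u → all? λ w → (E v u Bool.≟ true) →-dec (E v w Bool.≟ true) →-dec (u ≟ w)

  node≢leaf : ∀ {v} → IsNode T v → ∀ x → v ≢ leafOf x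
  node≢leaf nv x refl = nv (leafOf-leaf x)

-- Accessibility graphs that are connected cographs

P₄-distinct : ∀ {k} (e : Fin k → Fin k → Bool) → (∀ x y → e x y ≡ e y x) → (∀ x → e x x ≡ false) →
  ∀ {a b c d} → e a b ≡ true → e b c ≡ true → e c d ≡ true → e a c ≡ false → e a d ≡ false → e b d ≡ false →
  a ≢ b × a ≢ c × a ≢ d × b ≢ c × b ≢ d × c ≢ d
P₄-distinct e e-sym e-irr {a} {b} {c} {d} ab bc cd ac ad bd =
  (λ { refl → true≢false ab (e-irr a) }) , (λ { refl → true≢false cd ad }) ,
  (λ { refl → true≢false ab (trans (e-sym a b) bd) }) , (λ { refl → true≢false bc (e-irr b) }) ,
  (λ { refl → true≢false ab ad }) , (λ { refl → true≢false cd (e-irr c) })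

crossing : ∀ {k} {A : Fin k → Fin k → Bool} {Q : Fin k → Set} → (∀ x → Dec (Q x)) →
  ∀ {x y ps} → Walk A x y ps → Q x → ¬ Q y → ∃[ u ] ∃[ w ] (Q u × ¬ Q w × A u w ≡ true)
crossing Q? here Qx ¬Qy = ⊥-elim (¬Qy Qx)
crossing Q? (step {x = z} e w) Qx ¬Qy with Q? z
... | yes Qz = crossing Q? w Qz ¬Qy
... | no ¬Qz = _ , z , Qx , ¬Qz , e

module CographSplitTree (G : Graph) (conn : Connected G) (cograph : Cograph G)
  (T : GLT (Graph.n G)) (splitTree : IsSplitTree G T) where

  open Graph G
  open Accessibility T public

  P₄-free : ∀ {a b c d} → adj a b ≡ true → adj b c ≡ true → adj c d ≡ true →
    adj a c ≡ false → adj a d ≡ false → adj b d ≡ false → ⊥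
  P₄-free ab bc cd ac ad bd
    with ab≢ , ac≢ , ad≢ , bc≢ , bd≢ , cd≢ ← P₄-distinct adj adj-sym adj-irr ab bc cd ac ad bd
    = cograph (_ , _ , _ , _ , ab≢ , ac≢ , ad≢ , bc≢ , bd≢ , cd≢ , ab , bc , cd , ac , ad , bd)

  adj⇒linked : ∀ {x y} → adj x y ≡ true → Linked (leafOf x) (leafOf y)
  adj⇒linked {x} {y} h = Equivalence.to (accessible⇔linked _ _)
    (Equivalence.to (proj₁ splitTree x y (λ { refl → true≢false h (adj-irr x) })) h)

  linked⇒adj : ∀ {x y} → x ≢ y → Linked (leafOf x) (leafOf y) → adj x y ≡ true
  linked⇒adj {x} {y} x≢y h = Equivalence.from (proj₁ splitTree x y x≢y) (Equivalence.from (accessible⇔linked _ _) h)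

  three : ∀ {v} → IsNode T v → Three (E v)
  three {v} = proj₁ (proj₁ (proj₂ splitTree)) v

  -- A node `q` has a neighbour other than `p`, so the descent away from `p` can stop only at a
  -- leaf.
  branchLeaf : ∀ {p q} → E p q ≡ true → ∃[ x ] dir p (leafOf x) ≡ q
  branchLeaf e = go e (<-wellFounded _)
    where
    go : ∀ {p q} → E p q ≡ true → Acc _<_ (count (branch p q)) → ∃[ x ] dir p (leafOf x) ≡ q
    go {p} {q} e (acc rs) with isLeaf? q
    ... | yes lq with x , refl ← leafOf-onto q lq = x , dir-adj e
    ... | no nq
      with r , qr , r≢p , _ ← third {S = E q} (three nq) p p
      with x , h ← go qr (rs (branch-shrinks e qr r≢p))
      = x , other-side (swapE e) (λ k → r≢p (trans (sym h) k))

  -- Here connectedness of `G` enters: both sides of a tree edge contain leaves, so a walk in `G`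
  -- between them uses an edge that crosses.
  crossEdge : ∀ {p q} → E p q ≡ true →
    ∃[ x ] ∃[ y ] (dir p (leafOf x) ≡ q × dir q (leafOf y) ≡ p × adj x y ≡ true)
  crossEdge {p} {q} e
    with x , hx ← branchLeaf e | y , hy ← branchLeaf (swapE e)
    with u , w , hu , hw , uw ← crossing (λ z → dir p (leafOf z) ≟ q) (proj₁ (proj₂ (proj₂ conn x y)))
           hx (λ h → ¬both-sides e h hy)
    = u , w , hu , other-side e hw , uw

  -- Every marker of every label sees an accessible leaf, so each label is an induced subgraph of G.
  accessibleLeaf : ∀ {p q} → E p q ≡ true → ∃[ x ] (dir p (leafOf x) ≡ q × Linked p (leafOf x))
  accessibleLeaf {p} {q} e with x , y , hx , hy , xy ← crossEdge e with p ≟ leafOf y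
  ... | yes refl = x , hx , linked-sym (adj⇒linked xy)
  ... | no p≢y = x , hx , linked-part
          (λ { refl → E⇒≢ e (trans (sym (dir-refl p)) hx) }) p≢y
          (λ k → ¬both-sides e (trans (sym k) hx) hy) (adj⇒linked xy)

  adj-through : ∀ {v u w x y} → E v u ≡ true → E v w ≡ true → u ≢ w →
    dir v (leafOf x) ≡ u → Linked v (leafOf x) → dir v (leafOf y) ≡ w → Linked v (leafOf y) →
    adj x y ≡ lab v u w
  adj-through {v} vu vw u≢w refl lx refl ly = ⇔⇒≡
    (λ h → linked-lab (≢x vu) (≢x vw) u≢w (adj⇒linked h))
    (λ h → linked⇒adj (λ { refl → u≢w refl }) (linked-join h lx ly u≢w))
    where
    ≢x : ∀ {x} → E v (dir v x) ≡ true → v ≢ x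
    ≢x {x} e refl = E⇒≢ e (sym (dir-refl v))

  adj-blocked : ∀ {v u w x y} → IsNode T v → u ≢ w →
    dir v (leafOf x) ≡ u → dir v (leafOf y) ≡ w → lab v u w ≡ false → adj x y ≡ false
  adj-blocked nv u≢w refl refl h =
    ≢true⇒false (λ k → true≢false (linked-lab (node≢leaf nv _) (node≢leaf nv _) u≢w (adj⇒linked k)) h)

  labelP₄Free : ∀ v → P₄FreeOn (lab v) (lab-sym v) (E v)
  labelP₄Free v a b c d va vb vc vd ab bc cd ac ad bd
    with ab≢ , ac≢ , ad≢ , bc≢ , bd≢ , cd≢ ← P₄-distinct (lab v) (lab-sym v) (lab-irr v) ab bc cd ac ad bd
    with x , hx , lx ← accessibleLeaf va | y , hy , ly ← accessibleLeaf vb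
       | z , hz , lz ← accessibleLeaf vc | w , hw , lw ← accessibleLeaf vd
    = P₄-free
        (trans (adj-through va vb ab≢ hx lx hy ly) ab) (trans (adj-through vb vc bc≢ hy ly hz lz) bc)
        (trans (adj-through vc vd cd≢ hz lz hw lw) cd) (trans (adj-through va vc ac≢ hx lx hz lz) ac)
        (trans (adj-through va vd ad≢ hx lx hw lw) ad) (trans (adj-through vb vd bd≢ hy ly hw lw) bd)

  labelNoIsolated : ∀ {v} → IsNode T v → NoIsolated (lab v) (lab-sym v) (E v)
  labelNoIsolated {v} nv u vu with x , y , hx , hy , xy ← crossEdge vu =
    dir v (leafOf y) , dir-E (node≢leaf nv y) , w≢u ,
    subst (λ a → lab v a (dir v (leafOf y)) ≡ true) hx
      (linked-lab (node≢leaf nv x) (node≢leaf nv y) (λ q → w≢u (trans (sym q) hx)) (adj⇒linked xy))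
    where
    w≢u : dir v (leafOf y) ≢ u
    w≢u q = ¬both-sides vu q hy

  Clique : Fin t → Set
  Clique v = IsCliqueOn (E v) (lab v)

  Star : Fin t → Fin t → Set
  Star v c = IsStarCentredOn (E v) (lab v) c

  noAdjacentCliques : ∀ {u v} → E u v ≡ true → IsNode T u → IsNode T v → Clique u → Clique v → ⊥
  noAdjacentCliques e nu nv K K′ = proj₁ (proj₂ (proj₁ (proj₂ splitTree))) _ _ e nu nv (K , K′)

  noAdjacentStars : ∀ {u v c} → E u v ≡ true → IsNode T u → IsNode T v → Star u v → Star v c → c ≢ u → ⊥
  noAdjacentStars e nu nv s s′ c≢u = proj₂ (proj₂ (proj₁ (proj₂ splitTree))) _ _ e nu nv (s , _ , s′ , c≢u)

  degenerate : ∀ v → IsNode T v → Clique v ⊎ ∃[ c ] Star v c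
  degenerate v nv with proj₂ (proj₂ splitTree) v nv
  ... | inj₁ prime = primeDegenerate (lab v) (lab-sym v) (lab-irr v) (E v) (labelP₄Free v) (labelNoIsolated nv) (three nv) prime
  ... | inj₂ deg   = deg

  data Kind (v : Fin t) : Set where
    leaf   : IsLeaf E v → Kind v
    clique : IsNode T v → Clique v → Kind v
    star   : IsNode T v → ∀ c → Star v c → Kind v

  kind : ∀ v → Kind v
  kind v with isLeaf? v
  ... | yes lv = leaf lv
  ... | no nv with degenerate v nv
  ...   | inj₁ K       = clique nv K
  ...   | inj₂ (c , K) = star nv c K

  star-unique : ∀ {v c c′} → IsNode T v → Star v c → Star v c′ → c ≡ c′
  star-unique {v} {c} {c′} nv (vc , centre , _) (vc′ , _ , sparse) with c ≟ c′
  ... | yes q = q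
  ... | no c≢c′ with m , vm , m≢c , m≢c′ ← third {S = E v} (three nv) c c′ =
          ⊥-elim (true≢false (centre m vm m≢c) (sparse c m vc vm c≢c′ m≢c′))

  ¬star-clique : ∀ {v c} → IsNode T v → Star v c → Clique v → ⊥
  ¬star-clique {v} {c} nv (vc , _ , sparse) K
    with m , vm , m≢c , _ ← third {S = E v} (three nv) c c
    with l , vl , l≢c , l≢m ← third {S = E v} (three nv) c m
    = true≢false (K m l vm vl (l≢m ∘ sym)) (sparse m l vm vl m≢c l≢c)

  -- Leaves `a`, `b` behind an extremity and the centre of `u`, and `b′`, `a′` behind the centre and
  -- an extremity of `v`, induce the P₄ `a`, `b`, `b′`, `a′`. Linked instead of adjacent nodes are
  -- allowed because `up-unique` needs two stars that are separated by a clique.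
  ¬facing-extremities : ∀ {u v c c′} → u ≢ v → IsNode T u → IsNode T v → Linked u v →
    Star u c → c ≢ dir u v → Star v c′ → c′ ≢ dir v u → ⊥
  ¬facing-extremities {u} {v} {c} {c′} u≢v nu nv uv (uc , centre , sparse) c≢ (vc′ , centre′ , sparse′) c′≢
    with e , ue , e≢c , e≢m ← third {S = E u} (three nu) c (dir u v)
    with e′ , ve′ , e′≢c′ , e′≢m′ ← third {S = E v} (three nv) c′ (dir v u)
    with a , ha , la ← accessibleLeaf ue | b , hb , lb ← accessibleLeaf uc
       | b′ , hb′ , lb′ ← accessibleLeaf vc′ | a′ , ha′ , la′ ← accessibleLeaf ve′
    = P₄-free
        (trans (adj-through ue uc e≢c ha la hb lb) (trans (lab-sym u e c) (centre e ue e≢c)))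
        (trans (adj-through uc (dir-E u≢v) c≢ hb lb hub′ lub′) (centre _ (dir-E u≢v) (c≢ ∘ sym)))
        (trans (adj-through vc′ ve′ (e′≢c′ ∘ sym) hb′ lb′ ha′ la′) (centre′ e′ ve′ e′≢c′))
        (adj-blocked nu e≢m ha hub′ blocked)
        (adj-blocked nu e≢m ha (far u≢v ha′ e′≢m′) blocked)
        (trans (adj-sym b a′) (adj-blocked nv e′≢m′ ha′ (far (u≢v ∘ sym) hb c≢)
          (sparse′ e′ _ ve′ (dir-E (u≢v ∘ sym)) e′≢c′ (c′≢ ∘ sym))))
    where
    blocked : lab u e (dir u v) ≡ false
    blocked = sparse e _ ue (dir-E u≢v) e≢c (c≢ ∘ sym)
    far : ∀ {u v x m} → u ≢ v → dir v x ≡ m → m ≢ dir v u → dir u x ≡ dir u v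
    far u≢v refl h = dir-between (u≢v ∘ sym) (h ∘ sym)
    hub′ : dir u (leafOf b′) ≡ dir u v
    hub′ = far u≢v hb′ c′≢
    lub′ : Linked u (leafOf b′)
    lub′ = linked-join
      (trans (lab-sym v _ _) (subst (λ m → lab v m (dir v u) ≡ true) (sym hb′) (centre′ _ (dir-E (u≢v ∘ sym)) (c′≢ ∘ sym))))
      (linked-sym uv) lb′ (λ q → c′≢ (trans (sym hb′) (sym q)))

-- The rooted structure of the split tree of a connected cograph

module Orientation (G : Graph) (conn : Connected G) (cograph : Cograph G)
  (T : GLT (Graph.n G)) (splitTree : IsSplitTree G T) where

  open Graph G
  open CographSplitTree G conn cograph T splitTree public

  -- The parent relation of the cotree. Two vertices may be above each other: the edge
  -- between them then stands for a binary root.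
  data Up (v u : Fin t) : Set where
    leafUp   : IsLeaf E v → E v u ≡ true → Up v u
    starUp   : IsNode T v → Star v u → Up v u
    cliqueUp : IsNode T v → Clique v → E v u ≡ true → IsNode T u → ∀ {c} → Star u c → c ≢ v → Up v u

  up-edge : ∀ {v u} → Up v u → E v u ≡ true
  up-edge (leafUp _ e)             = e
  up-edge (starUp _ (e , _))       = e
  up-edge (cliqueUp _ _ e _ _ _)   = e

  up-universal : ∀ {v u w} → Up v u → E v w ≡ true → w ≢ u → lab v u w ≡ true
  up-universal (leafUp lv vu) vw w≢u = ⊥-elim (w≢u (lv _ _ vw vu))
  up-universal (starUp _ (_ , centre , _)) vw w≢u = centre _ vw w≢u
  up-universal (cliqueUp _ K vu _ _ _) vw w≢u = K _ _ vu vw (w≢u ∘ sym)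

  -- The clique case carries the idea: two parents `u` and `w` would be stars linked through the
  -- clique `v`, each turning an extremity towards it.
  up-unique : ∀ {v u w} → Up v u → Up v w → u ≡ w
  up-unique (leafUp lv e) U = lv _ _ e (up-edge U)
  up-unique U@(starUp nv _) (leafUp lv _) = ⊥-elim (nv lv)
  up-unique (starUp nv s) (starUp _ s′) = star-unique nv s s′
  up-unique (starUp nv s) (cliqueUp _ K _ _ _ _) = ⊥-elim (¬star-clique nv s K)
  up-unique (cliqueUp nv _ _ _ _ _) (leafUp lv _) = ⊥-elim (nv lv)
  up-unique (cliqueUp nv K _ _ _ _) (starUp _ s) = ⊥-elim (¬star-clique nv s K)
  up-unique {v} {u} {w} (cliqueUp _ K vu nu su cu) (cliqueUp _ _ vw nw sw cw) with u ≟ w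
  ... | yes q = q
  ... | no u≢w = ⊥-elim (¬facing-extremities u≢w nu nw linked
          su (λ q → cu (trans q (toward vu vw u≢w))) sw (λ q → cw (trans q (toward vw vu (u≢w ∘ sym)))))
    where
    toward : ∀ {u w} → E v u ≡ true → E v w ≡ true → u ≢ w → dir u w ≡ v
    toward vu vw u≢w = other-side vu (λ q → u≢w (trans (sym q) (dir-adj vw)))
    linked : Linked u w
    linked = linked-join (subst₂ (λ a b → lab v a b ≡ true) (sym (dir-adj vu)) (sym (dir-adj vw)) (K u w vu vw u≢w))
      (linked-edge vu) (linked-edge vw)
      (λ q → u≢w (trans (sym (dir-adj vu)) (trans q (dir-adj vw))))

  -- An edge without direction would join two cliques, which `Reduced` forbids, or two stars that
  -- face each other by extremities.
  up-total : ∀ {u v} → E u v ≡ true → Up u v ⊎ Up v u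
  up-total {u} {v} e with kind u | kind v
  ... | leaf lu | _       = inj₁ (leafUp lu e)
  ... | _       | leaf lv = inj₂ (leafUp lv (swapE e))
  ... | clique nu K | clique nv K′ = ⊥-elim (noAdjacentCliques e nu nv K K′)
  ... | clique nu K | star nv c s with c ≟ u
  ...   | yes refl = inj₂ (starUp nv s)
  ...   | no c≢u   = inj₁ (cliqueUp nu K e nv s c≢u)
  up-total {u} {v} e | star nu c s | clique nv K with c ≟ v
  ...   | yes refl = inj₁ (starUp nu s)
  ...   | no c≢v   = inj₂ (cliqueUp nv K (swapE e) nu s c≢v)
  up-total {u} {v} e | star nu c s | star nv c′ s′ with c ≟ v | c′ ≟ u
  ...   | yes refl | _        = inj₁ (starUp nu s)
  ...   | no _     | yes refl = inj₂ (starUp nv s′)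
  ...   | no c≢v   | no c′≢u  = ⊥-elim (¬facing-extremities (E⇒≢ e) nu nv (linked-edge e)
            s (λ q → c≢v (trans q (dir-adj e))) s′ (λ q → c′≢u (trans q (dir-adj (swapE e)))))

  abstract
    up? : ∀ v u → Dec (Up v u)
    up? v u with kind v
    ... | leaf lv with E v u Bool.≟ true
    ...   | yes e = yes (leafUp lv e)
    ...   | no ¬e = no (¬e ∘ up-edge)
    up? v u | star nv c s with c ≟ u
    ...   | yes refl = yes (starUp nv s)
    ...   | no c≢u   = no (λ U → c≢u (up-unique (starUp nv s) U))
    up? v u | clique nv K with E v u Bool.≟ true
    ...   | no ¬e = no (¬e ∘ up-edge)
    ...   | yes e with up-total e | kind u
    ...     | inj₁ U | _ = yes U
    ...     | inj₂ _ | star nu c s with c ≟ v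
    ...       | no c≢v   = yes (cliqueUp nv K e nu s c≢v)
    ...       | yes refl = no λ
                  { (leafUp lv _) → nv lv ; (starUp _ s′) → ¬star-clique nv s′ K
                  ; (cliqueUp _ _ _ _ s′ c≢v) → c≢v (star-unique nu s′ s) }
    up? v u | clique nv K | yes e | inj₂ _ | leaf lu = no λ
                  { (leafUp lv _) → nv lv ; (starUp _ s′) → ¬star-clique nv s′ K
                  ; (cliqueUp _ _ _ nu _ _) → nu lu }
    up? v u | clique nv K | yes e | inj₂ _ | clique nu K′ = no λ
                  { (leafUp lv _) → nv lv ; (starUp _ s′) → ¬star-clique nv s′ K
                  ; (cliqueUp _ _ _ _ s′ _) → ¬star-clique nu s′ K′ }

  -- v = a is included, since dir a a = a.
  Below : Fin t → Fin t → Set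
  Below a v = ¬ Up a (dir a v)

  below? : ∀ a v → Dec (Below a v)
  below? a v = ¬? (up? a (dir a v))

  ¬below : ∀ {a v} → ¬ Below a v → Up a (dir a v)
  ¬below {a} {v} = decidable-stable (up? a (dir a v))

  below-refl : ∀ a → Below a a
  below-refl a U = E⇒≢ (up-edge U) (sym (dir-refl a))

  below⇒dir : ∀ {b a v} → Up b a → Below b v → dir a v ≡ b
  below⇒dir {b} U B = other-side (up-edge U) (λ q → B (subst (Up b) (sym q) U))

  dir⇒below : ∀ {b a v} → Up b a → dir b v ≢ a → Below b v
  dir⇒below U h U′ = h (up-unique U′ U)

  child⇒below : ∀ {b a v} → Up b a → dir a v ≡ b → Below b v
  child⇒below U q = dir⇒below U (¬both-sides (swapE (up-edge U)) q)

  -- The first edge on the path from `a` to `v` points back to `a`. Its lower end has no second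
  -- parent, so the next edge points up as well, and so on down to `v`.
  below-up : ∀ {a v} → Below a v → v ≢ a → Up v (dir v a)
  below-up {a} {v} = go a (<-wellFounded (dist a v))
    where
    go : ∀ a → Acc _<_ (dist a v) → Below a v → v ≢ a → Up v (dir v a)
    go a (acc rs) B v≢a with up-total (dir-E (v≢a ∘ sym))
    ... | inj₁ U = ⊥-elim (B U)
    ... | inj₂ U with dir a v ≟ v
    ...   | yes q = subst (Up v) (sym (dir-adj (up-edge U′))) U′
      where
      U′ : Up v a
      U′ = subst (λ u → Up u a) q U
    ...   | no u≢v = subst (Up v) (dir-same (up-edge U) (u≢v ∘ sym) v≢a)
              (go (dir a v) (rs (dist-dir (v≢a ∘ sym))) (child⇒below U refl) (u≢v ∘ sym))

  -- Every interior vertex of the path has its parent in the direction of `a`, and the parent marker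
  -- is universal.
  linked-below : ∀ {a v} → Below a v → Linked a v
  linked-below {a} {v} B w w≢a w≢v h with dir a w ≟ dir a v
  ... | no q  = ⊥-elim (h (sym (dir-between (w≢a ∘ sym) q)))
  ... | yes q = up-universal (below-up (subst (λ d → ¬ Up a d) (sym q) B) w≢a) (dir-E w≢v) (h ∘ sym)

  -- Of at least three markers at most one points up, so two or more point down and one of these
  -- differs from `u`.
  down-marker : ∀ {a} → IsNode T a → ∀ u → ∃[ m ] (E a m ≡ true × m ≢ u × ¬ Up a m)
  down-marker {a} na u with any? (up? a)
  ... | yes (p , U) with m , am , m≢u , m≢p ← third {S = E a} (three na) u p = m , am , m≢u , m≢p ∘ λ U′ → up-unique U′ U
  ... | no none with m , am , m≢u , _ ← third {S = E a} (three na) u u = m , am , m≢u , λ U → none (m , U)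

  In : Fin t → Fin n → Set
  In a x = Below a (leafOf x)

  escape : ∀ a u → a ≢ u → ∃[ x ] (In a x × dir a (leafOf x) ≢ u)
  escape a u a≢u with isLeaf? a
  ... | yes la with x , refl ← leafOf-onto a la = x , below-refl a , λ q → a≢u (trans (sym (dir-refl a)) q)
  ... | no na with m , am , m≢u , ¬U ← down-marker na u with x , h ← branchLeaf am =
          x , (λ U → ¬U (subst (Up a) h U)) , λ q → m≢u (trans (sym h) q)

  inhabited : ∀ a → ∃[ x ] In a x
  inhabited a with isLeaf? a
  ... | yes la with x , refl ← leafOf-onto a la = x , below-refl a
  ... | no na with m , am , _ ← down-marker na a with x , h , _ ← escape a m (E⇒≢ am) = x , h

  -- A leaf below `a` that is not in the direction of `b` is seen from `b` in the direction of `a`,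
  -- which is upwards.
  escape-⊈ : ∀ {a b} → a ≢ b → Up b (dir b a) → ∃[ x ] (In a x × ¬ In b x)
  escape-⊈ {a} {b} a≢b U with x , h , q ← escape a (dir a b) (E⇒≢ (dir-E a≢b)) =
    x , h , λ h′ → h′ (subst (Up b) (sym (dir-between a≢b (q ∘ sym))) U)

  -- A path from `x` to `z` climbs to `a` and leaves it by the universal parent marker, so only the
  -- part beyond `a` can block it. As that part does not depend on `x`, the leaves below `a` form a
  -- module.
  adj-outside : ∀ {a x z} → In a x → ¬ In a z → adj x z ≡ true ⇔ Linked a (leafOf z)
  adj-outside {a} {x} {z} Bx ¬Bz with a ≟ leafOf x
  ... | yes refl = mk⇔ adj⇒linked (linked⇒adj (λ { refl → ¬Bz Bx }))
  ... | no a≢x = mk⇔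
        (λ h → linked-part a≢z a≢x (λ q → Bx (subst (Up a) q U)) (linked-sym (adj⇒linked h)))
        (λ h → linked⇒adj (λ { refl → ¬Bz Bx }) (linked-join
          (trans (lab-sym a _ _) (up-universal U (dir-E a≢x) (λ q → Bx (subst (Up a) (sym q) U))))
          (linked-below Bx) h (λ q → Bx (subst (Up a) (sym q) U))))
    where
    U : Up a (dir a (leafOf z))
    U = ¬below ¬Bz
    a≢z : a ≢ leafOf z
    a≢z refl = ¬Bz (below-refl a)

  In-module : ∀ {a x x′ z} → In a x → In a x′ → ¬ In a z → adj x z ≡ adj x′ z
  In-module Bx Bx′ ¬Bz = ⇔⇒≡
    (λ h → Equivalence.from (adj-outside Bx′ ¬Bz) (Equivalence.to (adj-outside Bx ¬Bz) h))
    (λ h → Equivalence.from (adj-outside Bx ¬Bz) (Equivalence.to (adj-outside Bx′ ¬Bz) h))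

  -- The marker of the edge is universal at both ends, so the two sides are completely joined, like
  -- the children of a series root.
  adj-root : ∀ {a p x z} → Up a p → Up p a → In a x → ¬ In a z → adj x z ≡ true
  adj-root {a} {p} {x} {z} U U′ Bx ¬Bz = Equivalence.from (adj-outside Bx ¬Bz) linked
    where
    pz≢a : dir p (leafOf z) ≢ a
    pz≢a = ¬both-sides (up-edge U) (sym (up-unique U (¬below ¬Bz)))
    linked : Linked a (leafOf z)
    linked with p ≟ leafOf z
    ... | yes refl = linked-edge (up-edge U)
    ... | no p≢z = linked-join
          (subst (λ m → lab p m (dir p (leafOf z)) ≡ true) (sym (dir-adj (up-edge U′))) (up-universal U′ (dir-E p≢z) pz≢a))
          (linked-edge (up-edge U′)) (linked-below (dir⇒below U′ pz≢a))
          (λ q → pz≢a (trans (sym q) (dir-adj (up-edge U′))))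

  adj-lab : ∀ {a x y} → IsNode T a → In a x → In a y → dir a (leafOf x) ≢ dir a (leafOf y) →
    adj x y ≡ lab a (dir a (leafOf x)) (dir a (leafOf y))
  adj-lab na Bx By h = adj-through (dir-E (node≢leaf na _)) (dir-E (node≢leaf na _)) h
    refl (linked-below Bx) refl (linked-below By)

  -- true: series, false: parallel (junk on leaves)
  colour : Fin t → Bool
  colour a with kind a
  ... | leaf _     = true
  ... | clique _ _ = true
  ... | star _ _ _ = false

  lab-colour : ∀ {a u w} → IsNode T a → E a u ≡ true → E a w ≡ true → u ≢ w → ¬ Up a u → ¬ Up a w →
    lab a u w ≡ colour a
  lab-colour {a} na au aw u≢w ¬Uu ¬Uw with kind a
  ... | leaf la    = ⊥-elim (na la)
  ... | clique _ K = K _ _ au aw u≢w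
  ... | star _ c s@(_ , _ , sparse) = sparse _ _ au aw (λ { refl → ¬Uu (starUp na s) }) (λ { refl → ¬Uw (starUp na s) })

  adj-colour : ∀ {a x y} → IsNode T a → In a x → In a y → dir a (leafOf x) ≢ dir a (leafOf y) → adj x y ≡ colour a
  adj-colour na Bx By h = trans (adj-lab na Bx By h)
    (lab-colour na (dir-E (node≢leaf na _)) (dir-E (node≢leaf na _)) h Bx By)

  parent-node : ∀ {a p} → Up a p → ¬ Up p a → IsNode T p
  parent-node U ¬U′ lp = ¬U′ (leafUp lp (swapE (up-edge U)))

  -- Two series nodes would be adjacent cliques. Of two parallel nodes, `a` has its centre at `p`,
  -- while `p`, whose parent is not `a`, shows `a` an extremity: both configurations contradict
  -- `Reduced`.
  colour-alternates : ∀ {a p} → IsNode T a → Up a p → ¬ Up p a → colour a ≢ colour p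
  colour-alternates {a} {p} na U ¬U′ with kind a | kind p
  ... | leaf la | _ = ⊥-elim (na la)
  ... | _ | leaf lp = ⊥-elim (parent-node U ¬U′ lp)
  ... | clique _ K | clique np K′ =
        ⊥-elim (noAdjacentCliques (up-edge U) na np K K′)
  ... | clique _ _ | star _ _ _ = λ ()
  ... | star _ _ _ | clique _ _ = λ ()
  ... | star _ c s | star np c′ s′ with refl ← up-unique U (starUp na s) =
        ⊥-elim (noAdjacentStars (up-edge U) na np s s′ (λ { refl → ¬U′ (starUp np s′) }))

  -- A clique `a` could only have a star `p` as parent, with its centre elsewhere; but `p` points
  -- back to `a`, so its centre is at `a`.
  colour-root : ∀ {a p} → IsNode T a → Up a p → Up p a → colour a ≡ false
  colour-root {a} na U U′ with kind a
  ... | leaf la = ⊥-elim (na la)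
  ... | star _ _ _ = refl
  ... | clique _ K with U
  ...   | leafUp la _ = ⊥-elim (na la)
  ...   | starUp _ s  = ⊥-elim (¬star-clique na s K)
  ...   | cliqueUp _ _ _ np s c≢a with U′
  ...     | leafUp lp _ = ⊥-elim (np lp)
  ...     | starUp _ s′ = ⊥-elim (c≢a (star-unique np s s′))
  ...     | cliqueUp _ K′ _ _ _ _ = ⊥-elim (¬star-clique np s K′)

  -- When `x` and `y` lie behind the same marker, a leaf `w` below another child of `a` sees both in
  -- the colour of `a`.
  colour-witness : ∀ {a x y} → IsNode T a → In a x → In a y →
    adj x y ≡ colour a ⊎ ∃[ w ] (In a w × adj w x ≡ colour a × adj w y ≡ colour a)
  colour-witness {a} {x} {y} na Bx By with dir a (leafOf x) ≟ dir a (leafOf y)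
  ... | no h = inj₁ (adj-colour na Bx By h)
  ... | yes q with m , am , m≢ , ¬U ← down-marker na (dir a (leafOf x)) with w , h ← branchLeaf am =
        inj₂ (w , Bw , adj-colour na Bw Bx (λ r → m≢ (trans (sym h) r)) ,
                       adj-colour na Bw By (λ r → m≢ (trans (sym h) (trans r (sym q)))))
    where
    Bw : In a w
    Bw U = ¬U (subst (Up a) h U)

-- Strong modules

module _ (G : Graph) where
  open Graph G

  ⊈⇒∃ : ∀ {S S′ : VSet G} → ¬ _⊆_ G S S′ → ∃[ x ] (Mem S x × S′ x ≡ false)
  ⊈⇒∃ {S} {S′} h with any? (λ x → (S x Bool.≟ true) ×-dec (S′ x Bool.≟ false))
  ... | yes w = w
  ... | no none = ⊥-elim (h (λ x Sx → ≢false⇒true (λ q → none (x , Sx , q))))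

  ∃⇒⊈ : ∀ {S S′ : VSet G} {x} → Mem S x → S′ x ≡ false → ¬ _⊆_ G S S′
  ∃⇒⊈ Sx S′x h = true≢false (h _ Sx) S′x

  ⊆-antisym : ∀ {S S′ : VSet G} → _⊆_ G S S′ → _⊆_ G S′ S → _≐_ G S S′
  ⊆-antisym f g x = ⇔⇒≡ (f x) (g x)

  ≐-sym : ∀ {S S′ : VSet G} → _≐_ G S S′ → _≐_ G S′ S
  ≐-sym h x = sym (h x)

  ≐-trans : ∀ {S S′ S″ : VSet G} → _≐_ G S S′ → _≐_ G S′ S″ → _≐_ G S S″
  ≐-trans h k x = trans (h x) (k x)

  ≐⇒⊆ : ∀ {S S′ : VSet G} → _≐_ G S S′ → _⊆_ G S S′
  ≐⇒⊆ h x m = trans (sym (h x)) m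

  ⊂-resp : ∀ {S S′ P P′ : VSet G} → _≐_ G S S′ → _≐_ G P P′ → _⊂_ G S P → _⊂_ G S′ P′
  ⊂-resp h k (sub , x , Px , Sx) =
    (λ y m → ≐⇒⊆ k y (sub y (≐⇒⊆ (≐-sym h) y m))) , x , trans (sym (k x)) Px , trans (sym (h x)) Sx

  IsModule-resp : ∀ {S S′ : VSet G} → _≐_ G S S′ → IsModule G S → IsModule G S′
  IsModule-resp h mod x y z Sx Sy Sz = mod x y z (trans (h x) Sx) (trans (h y) Sy) (trans (h z) Sz)

  IsStrong-resp : ∀ {S S′ : VSet G} → _≐_ G S S′ → IsStrong G S → IsStrong G S′
  IsStrong-resp h ((x , Sx) , mod , nov) = (x , ≐⇒⊆ h x Sx) , IsModule-resp h mod ,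
    λ Q mq ((y , Sy , Qy) , n₁ , n₂) → nov Q mq
      ( (y , ≐⇒⊆ (≐-sym h) y Sy , Qy)
      , (λ k → n₁ (λ z m → k z (≐⇒⊆ (≐-sym h) z m)))
      , (λ k → n₂ (λ z m → ≐⇒⊆ h z (k z m))))

  Child-resp : ∀ {S S′ P P′ : VSet G} → _≐_ G S S′ → _≐_ G P P′ → Child G S P → Child G S′ P′
  Child-resp h k (s , p , lt , max) = IsStrong-resp h s , IsStrong-resp k p , ⊂-resp h k lt ,
    λ Q q l₁ l₂ → max Q q (⊂-resp (≐-sym h) (λ _ → refl) l₁) (⊂-resp (λ _ → refl) (≐-sym k) l₂)

  ModAdj-resp : ∀ {S S′ P P′ : VSet G} → _≐_ G S S′ → _≐_ G P P′ → ModAdj G S P → ModAdj G S′ P′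
  ModAdj-resp h k (x , y , Sx , Py , xy) = x , y , ≐⇒⊆ h x Sx , ≐⇒⊆ k y Py , xy

  noOverlap : ∀ {S Q : VSet G} {x y z} → IsStrong G S → IsModule G Q →
    Mem S x → Mem Q x → Mem S y → Q y ≡ false → S z ≡ false → Mem Q z → ⊥
  noOverlap {Q = Q} (_ , _ , nov) mq Sx Qx Sy Qy Sz Qz =
    nov Q mq ((_ , Sx , Qx) , ∃⇒⊈ Sy Qy , ∃⇒⊈ Qz Sz)

  full-strong : Fin n → IsStrong G (full G)
  full-strong x = (x , refl) , (λ _ _ _ _ _ ()) , λ _ _ (_ , _ , h) → h (λ _ _ → refl)

  two-classes : ∀ {S₁ S₂ S₃ C C′ : VSet G} → _≐_ G S₁ C ⊎ _≐_ G S₁ C′ → _≐_ G S₂ C ⊎ _≐_ G S₂ C′ →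
    _≐_ G S₃ C ⊎ _≐_ G S₃ C′ → _≐_ G S₁ S₂ ⊎ _≐_ G S₁ S₃ ⊎ _≐_ G S₂ S₃
  two-classes (inj₁ p) (inj₁ q) _        = inj₁ (≐-trans p (≐-sym q))
  two-classes (inj₂ p) (inj₂ q) _        = inj₁ (≐-trans p (≐-sym q))
  two-classes (inj₁ p) (inj₂ _) (inj₁ r) = inj₂ (inj₁ (≐-trans p (≐-sym r)))
  two-classes (inj₂ p) (inj₁ _) (inj₂ r) = inj₂ (inj₁ (≐-trans p (≐-sym r)))
  two-classes (inj₁ _) (inj₂ q) (inj₂ r) = inj₂ (inj₂ (≐-trans q (≐-sym r)))
  two-classes (inj₂ _) (inj₁ q) (inj₁ r) = inj₂ (inj₂ (≐-trans q (≐-sym r)))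

-- The split tree of a connected cograph is its modular tree

module ModularOfSplit (G : Graph) (conn : Connected G) (cograph : Cograph G)
  (T : GLT (Graph.n G)) (splitTree : IsSplitTree G T) where

  open Graph G
  open Orientation G conn cograph T splitTree public

  σ : Fin t → VSet G
  σ a x = does (below? a (leafOf x))

  σ⁺ : ∀ {a x} → In a x → σ a x ≡ true
  σ⁺ = dec-true (below? _ _)

  σ⁻ : ∀ {a x} → σ a x ≡ true → In a x
  σ⁻ = does-true (below? _ _)

  ¬σ⁺ : ∀ {a x} → ¬ In a x → σ a x ≡ false
  ¬σ⁺ = dec-false (below? _ _)

  ¬σ⁻ : ∀ {a x} → σ a x ≡ false → ¬ In a x
  ¬σ⁻ = does-false (below? _ _)

  σ-module : ∀ a → IsModule G (σ a)
  σ-module a x y z Sx Sy Sz = In-module (σ⁻ Sx) (σ⁻ Sy) (¬σ⁻ Sz)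

  -- An overlapping module `Q` would force the colour of `a` on the pair `x`, `z`, hence beyond `a`,
  -- where the colour of the parent is the opposite one. At an edge that points both ways, `a` is
  -- parallel while the two sides are completely joined.
  σ-noOverlap : ∀ {a Q x y z} → IsModule G Q → In a x → Q x ≡ true → In a y → Q y ≡ false → ¬ In a z → Q z ≡ true → ⊥
  σ-noOverlap {a} {Q} {x} {y} {z} mq ax Qx ay Qy ¬az Qz with isLeaf? a
  ... | yes la = true≢false Qx (trans (cong Q (leafOf-inj x y (trans (isA x ax) (sym (isA y ay))))) Qy)
    where
    isA : ∀ v → In a v → leafOf v ≡ a
    isA v av with a ≟ leafOf v
    ... | yes q = sym q
    ... | no a≢v = ⊥-elim (av (leafUp la (dir-E a≢v)))
  ... | no na = contra
    where
    p = dir a (leafOf z)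
    U : Up a p
    U = ¬below ¬az
    yx : adj y z ≡ adj x z
    yx = In-module ay ax ¬az
    xy : adj x y ≡ adj x z
    xy = trans (mq x z y Qx Qz Qy) (trans (adj-sym z y) yx)
    colour-a : colour a ≡ adj x z
    colour-a with colour-witness na ax ay
    ... | inj₁ h = trans (sym h) xy
    ... | inj₂ (w , aw , wx , wy) with Q w in Qw
    ...   | true  = trans (sym wy) (trans (mq w x y Qw Qx Qy) xy)
    ...   | false = trans (sym wx) (trans (adj-sym w x) (trans (mq x z w Qx Qz Qw)
                      (trans (adj-sym z w) (In-module aw ax ¬az))))
    contra : ⊥
    contra with up? p a
    ... | yes U′ = true≢false (adj-root U U′ ax ¬az) (trans (sym colour-a) (colour-root na U U′))
    -- The leaf `w` is below `p` but not below `a`. Alternation puts `z` outside `p`; then, whether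
    -- `w` is in `Q` or not, the module property of `Q` equates the colours of `a` and `p`.
    ... | no ¬U′ with w , pw , h ← escape p a (E⇒≢ (swapE (up-edge U))) = last
      where
      np = parent-node U ¬U′
      lift : ∀ {v} → In a v → dir p (leafOf v) ≡ a
      lift = below⇒dir U
      liftIn : ∀ {v} → In a v → In p v
      liftIn av U″ = ¬U′ (subst (Up p) (lift av) U″)
      pcol : ∀ {v} → In a v → adj w v ≡ colour p
      pcol av = adj-colour np pw (liftIn av) (λ q → h (trans q (lift av)))
      ¬pz : ¬ In p z
      ¬pz pz = colour-alternates na U ¬U′ (trans colour-a (adj-colour np (liftIn ax) pz
        (λ q → ¬both-sides (up-edge U) refl (trans (sym q) (lift ax)))))
      wz : adj w z ≡ adj x z
      wz = In-module pw (liftIn ax) ¬pz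
      last : ⊥
      last with Q w in Qw
      ... | true  = colour-alternates na U ¬U′
                      (trans colour-a (trans (sym xy) (trans (sym (mq w x y Qw Qx Qy)) (pcol ay))))
      ... | false = colour-alternates na U ¬U′
                      (trans colour-a (trans (sym wz) (trans (adj-sym w z) (trans (sym (mq x z w Qx Qz Qw))
                        (trans (adj-sym x w) (pcol ax))))))

  σ-strong : ∀ a → IsStrong G (σ a)
  σ-strong a with x , ax ← inhabited a = (x , σ⁺ ax) , σ-module a , λ Q mq ((v , av , Qv) , n₁ , n₂) →
    let y , ay , Qy = ⊈⇒∃ G n₁
        z , Qz , az = ⊈⇒∃ G n₂
    in σ-noOverlap mq (σ⁻ av) Qv (σ⁻ ay) Qy (¬σ⁻ az) Qz

  child-In : ∀ {b a x} → Up b a → ¬ Up a b → In b x → In a x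
  child-In {a = a} U ¬U′ bx U″ = ¬U′ (subst (Up a) (below⇒dir U bx) U″)

  -- Otherwise S together with one further child of a would overlap S.
  noBetween : ∀ {b a S y z} → Up b a → ¬ Up a b → IsStrong G S → (∀ x → In b x → Mem S x) →
    Mem S z → ¬ In b z → In a z → S y ≡ false → In a y → ⊥
  noBetween {b} {a} {S} {y} {z} U ¬U′ strong sub Sz ¬bz az Sy ay
    with x , bx ← inhabited b | dir a (leafOf z) ≟ dir a (leafOf y)
  -- Here `y` and `z` lie below the same child `m` of `a`, and `σ m` itself overlaps `S`.
  ... | yes zy = noOverlap G strong (σ-module m) Sz (σ⁺ mz) (sub x bx) (¬σ⁺ ¬mx) Sy (σ⁺ (child⇒below Um refl))
    where
    m = dir a (leafOf y)
    na = parent-node U ¬U′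
    Um : Up m a
    Um with up-total (dir-E (node≢leaf na y))
    ... | inj₁ U″ = ⊥-elim (ay U″)
    ... | inj₂ U″ = U″
    mz : In m z
    mz = child⇒below Um zy
    m≢b : m ≢ b
    m≢b q = true≢false (sub y (child⇒below U q)) Sy
    ¬mx : ¬ In m x
    ¬mx mx = m≢b (trans (sym (below⇒dir Um mx)) (below⇒dir U bx))
  -- The leaves below `b` and those below the child with `y` form a module, because all children of
  -- `a` see one another in one colour. It overlaps `S`.
  ... | no zy = noOverlap G strong union-module (sub x bx) (dec-true (union? x) (inj₁ (below⇒dir U bx)))
        Sz (dec-false (union? z) [ (λ q → ¬bz (child⇒below U q)) , zy ]′)
        Sy (dec-true (union? y) (inj₂ refl))
    where
    na = parent-node U ¬U′
    Union : Fin n → Set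
    Union v = dir a (leafOf v) ≡ b ⊎ dir a (leafOf v) ≡ dir a (leafOf y)
    union? : ∀ v → Dec (Union v)
    union? v = (dir a (leafOf v) ≟ b) ⊎-dec (dir a (leafOf v) ≟ dir a (leafOf y))
    union-In : ∀ {v} → Union v → In a v
    union-In (inj₁ q) U″ = ¬U′ (subst (Up a) q U″)
    union-In (inj₂ q) U″ = ay (subst (Up a) q U″)
    apart : ∀ {u v} → Union u → ¬ Union v → dir a (leafOf u) ≢ dir a (leafOf v)
    apart (inj₁ p) h q = h (inj₁ (trans (sym q) p))
    apart (inj₂ p) h q = h (inj₂ (trans (sym q) p))
    union-module : IsModule G (does ∘ union?)
    union-module u u′ v hu hu′ hv = go (does-true (union? u) hu) (does-true (union? u′) hu′) (does-false (union? v) hv)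
      where
      go : Union u → Union u′ → ¬ Union v → adj u v ≡ adj u′ v
      go hu hu′ hv with below? a (leafOf v)
      ... | no ¬av = In-module (union-In hu) (union-In hu′) ¬av
      ... | yes av = trans (adj-colour na (union-In hu) av (apart hu hv))
                           (sym (adj-colour na (union-In hu′) av (apart hu′ hv)))

  child-⊂ : ∀ {b a} → Up b a → ¬ Up a b → _⊂_ G (σ b) (σ a)
  child-⊂ {b} {a} U ¬U′ with x , ax , ¬bx ← escape-⊈ (E⇒≢ (swapE (up-edge U))) (subst (Up b) (sym (dir-adj (up-edge U))) U) =
    (λ v bv → σ⁺ (child-In U ¬U′ (σ⁻ bv))) , x , σ⁺ ax , ¬σ⁺ ¬bx

  child-Child : ∀ {b a} → Up b a → ¬ Up a b → Child G (σ b) (σ a)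
  child-Child U ¬U′ = σ-strong _ , σ-strong _ , child-⊂ U ¬U′ , λ Q q (bQ , z , Qz , bz) (Qa , y , ay , Qy) →
    noBetween U ¬U′ q (λ x bx → bQ x (σ⁺ bx)) Qz (¬σ⁻ bz) (σ⁻ (Qa z Qz)) Qy (σ⁻ ay)

  σ-inj : ∀ a b → _≐_ G (σ a) (σ b) → a ≡ b
  σ-inj a b h with a ≟ b
  ... | yes q = q
  ... | no a≢b with below? a b
  ...   | yes B with x , ax , ¬bx ← escape-⊈ a≢b (below-up B (a≢b ∘ sym)) =
            ⊥-elim (true≢false (trans (sym (h x)) (σ⁺ ax)) (¬σ⁺ ¬bx))
  ...   | no ¬B with x , bx , ¬ax ← escape-⊈ (a≢b ∘ sym) (¬below ¬B) =
            ⊥-elim (true≢false (trans (h x) (σ⁺ bx)) (¬σ⁺ ¬ax))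

  module RootEdge {a p : Fin t} (U : Up a p) (U′ : Up p a) where

    disjoint : ∀ {x} → In a x → ¬ In p x
    disjoint ax px = ¬both-sides (up-edge U) (below⇒dir U′ px) (below⇒dir U ax)

    cover : ∀ {x} → ¬ In a x → In p x
    cover ¬ax = child⇒below U′ (up-unique (¬below ¬ax) U)

    -- A strong module properly containing one end would overlap the other.
    above-full : ∀ {S z} → IsStrong G S → (∀ x → In a x → Mem S x) → Mem S z → ¬ In a z → ∀ y → Mem S y
    above-full {S} {z} strong sub Sz ¬az y with below? a (leafOf y)
    ... | yes ay = sub y ay
    ... | no ¬ay with x , ax ← inhabited a = ≢false⇒true λ Sy →
            noOverlap G strong (σ-module p) Sz (σ⁺ (cover ¬az)) (sub x ax) (¬σ⁺ (disjoint ax)) Sy (σ⁺ (cover ¬ay))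

    childOfFull : Child G (σ a) (full G)
    childOfFull with x , px ← inhabited p =
      σ-strong a , full-strong G x , ((λ _ _ → refl) , x , refl , ¬σ⁺ (λ ax → disjoint ax px)) ,
      λ Q q (aQ , z , Qz , az) (_ , y , _ , Qy) →
        true≢false (above-full q (λ v av → aQ v (σ⁺ av)) Qz (¬σ⁻ az) y) Qy

    -- `C` and `σ a` meet without overlapping. `C` cannot be larger, since it would then be
    -- everything by `above-full`, nor smaller, since it is maximal below V(G).
    child-meeting : ∀ {C c} → Child G C (full G) → Mem C c → In a c → _≐_ G C (σ a)
    child-meeting {C} {c} (strong , _ , (_ , y , _ , Cy) , max) Cc ac = ⊆-antisym G C⊆ ⊆C
      where
      C⊆ : _⊆_ G C (σ a)
      C⊆ z Cz = ≢false⇒true λ az → true≢false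
        (above-full strong (λ x ax → ≢false⇒true λ Cx →
            noOverlap G strong (σ-module a) Cc (σ⁺ ac) Cz az Cx (σ⁺ ax)) Cz (¬σ⁻ az) y) Cy
      ⊆C : _⊆_ G (σ a) C
      ⊆C x ax = ≢false⇒true λ Cx → max (σ a) (σ-strong a) (C⊆ , x , ax , Cx) (proj₁ (proj₂ (proj₂ childOfFull)))

  childOfFull-cases : ∀ {a p C} → Up a p → Up p a → Child G C (full G) → _≐_ G C (σ a) ⊎ _≐_ G C (σ p)
  childOfFull-cases {a} U U′ ch@(((c , Cc) , _) , _) with below? a (leafOf c)
  ... | yes ac = inj₁ (RootEdge.child-meeting U U′ ch Cc ac)
  ... | no ¬ac = inj₂ (RootEdge.child-meeting U′ U ch Cc (RootEdge.cover U U′ ¬ac))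

  rootBinary : ∀ {a p} → Up a p → Up p a → RootBinary G
  rootBinary {a} {p} U U′ = σ a , σ p , RootEdge.childOfFull U U′ , RootEdge.childOfFull U′ U ,
    (λ h → E⇒≢ (up-edge U) (σ-inj a p h)) , λ C ch → childOfFull-cases U U′ ch

  -- If `S` exceeds `σ a`, it is compared with the parent `p`: it cannot overlap `σ p`, and
  -- `noBetween` keeps it from lying strictly between `σ a` and `σ p`, so `σ p` is again inside `S`.
  -- At an edge that points both ways `S` is everything.
  climb : ∀ S → IsStrong G S → ∀ a → _⊆_ G (σ a) S →
    (∃[ b ] _≐_ G (σ b) S) ⊎ (RootBinary G × _≐_ G S (full G))
  climb S strong a = go a (<-wellFounded _)
    where
    go : ∀ a → Acc _<_ (count (not ∘ σ a)) → _⊆_ G (σ a) S →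
      (∃[ b ] _≐_ G (σ b) S) ⊎ (RootBinary G × _≐_ G S (full G))
    go a (acc rs) sub with any? (λ z → (S z Bool.≟ true) ×-dec (σ a z Bool.≟ false))
    ... | no none = inj₁ (a , ⊆-antisym G sub (λ z Sz → ≢false⇒true (λ az → none (z , Sz , az))))
    ... | yes (z , Sz , az) with up? (dir a (leafOf z)) a
    ...   | yes U′ = inj₂ (rootBinary U U′ , RootEdge.above-full U U′ strong (λ x ax → sub x (σ⁺ ax)) Sz (¬σ⁻ az))
      where
      U = ¬below (¬σ⁻ az)
    ...   | no ¬U′ with any? (λ y → (σ p y Bool.≟ true) ×-dec (S y Bool.≟ false))
      where
      p = dir a (leafOf z)
    ...     | no none = go p (rs (count-strict (not ∘ σ p) (not ∘ σ a) shrink x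
                  (cong not px) (cong not ax)))
                (λ y py → ≢false⇒true (λ Sy → none (y , py , Sy)))
      where
      p = dir a (leafOf z)
      U = ¬below (¬σ⁻ az)
      strict = child-⊂ U ¬U′
      x = proj₁ (proj₂ strict)
      px = proj₁ (proj₂ (proj₂ strict))
      ax = proj₂ (proj₂ (proj₂ strict))
      shrink : ∀ i → not (σ p i) ≡ true → not (σ a i) ≡ true
      shrink i h = cong not (≢true⇒false (λ ai → true≢false (proj₁ strict i ai) (Bool.not-injective h)))
    ...     | yes (y , py , Sy) with below? (dir a (leafOf z)) (leafOf z)
    ...       | yes pz = ⊥-elim (noBetween (¬below (¬σ⁻ az)) ¬U′ strong (λ x ax → sub x (σ⁺ ax)) Sz (¬σ⁻ az) pz Sy (σ⁻ py))
    ...       | no ¬pz with x , ax ← inhabited a =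
                  ⊥-elim (noOverlap G strong (σ-module _) (sub x (σ⁺ ax)) (σ⁺ (child-In (¬below (¬σ⁻ az)) ¬U′ ax))
                    Sz (¬σ⁺ ¬pz) Sy py)

  σ-leaf : ∀ x → _≐_ G (σ (leafOf x)) (singleton G x)
  σ-leaf x y with x ≟ y
  ... | yes refl = σ⁺ (below-refl (leafOf x))
  ... | no x≢y = ¬σ⁺ (λ h → h (leafUp (leafOf-leaf x) (dir-E (λ q → x≢y (leafOf-inj x y q)))))

  σ-onto : ∀ S → IsStrong G S → ¬ (RootBinary G × _≐_ G S (full G)) → ∃[ a ] _≐_ G (σ a) S
  σ-onto S strong@((x , Sx) , _) ¬root with climb S strong (leafOf x) sub
    where
    sub : _⊆_ G (σ (leafOf x)) S
    sub y h with x ≟ y | σ-leaf x y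
    ... | yes refl | _ = Sx
    ... | no _     | k = ⊥-elim (true≢false h k)
  ... | inj₁ found = found
  ... | inj₂ root  = ⊥-elim (¬root root)

  full⇒noUp : ∀ {a} → _≐_ G (σ a) (full G) → ∀ {u} → ¬ Up a u
  full⇒noUp {a} h U with x , q ← branchLeaf (up-edge U) = σ⁻ (h x) (subst (Up a) (sym q) U)

  -- A node with all leaves below it would give V(G) at least three different children. If `a` is a
  -- leaf, `G` has a single vertex and V(G) has no child.
  σ-noRoot : RootBinary G → ∀ a → ¬ _≐_ G (σ a) (full G)
  σ-noRoot (C₁ , C₂ , (((c , C₁c) , _) , _ , (_ , d , _ , C₁d) , _) , _ , _ , only) a h with isLeaf? a
  ... | yes la = true≢false C₁c (subst (λ v → C₁ v ≡ false) (leafOf-inj d c (trans (isA d) (sym (isA c)))) C₁d)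
    where
    isA : ∀ v → leafOf v ≡ a
    isA v with a ≟ leafOf v
    ... | yes q = sym q
    ... | no a≢v = ⊥-elim (full⇒noUp h (leafUp la (dir-E a≢v)))
  ... | no na with u , v , w , u≢v , u≢w , v≢w , au , av , aw ← three na
              = pigeon (two-classes G (cases au) (cases av) (cases aw))
    where
    cases : ∀ {u} → E a u ≡ true → _≐_ G (σ u) C₁ ⊎ _≐_ G (σ u) C₂
    cases {u} au with up-total au
    ... | inj₁ U = ⊥-elim (full⇒noUp h U)
    ... | inj₂ U = only (σ u) (Child-resp G (λ _ → refl) h (child-Child U (full⇒noUp h)))
    pigeon : _≐_ G (σ u) (σ v) ⊎ _≐_ G (σ u) (σ w) ⊎ _≐_ G (σ v) (σ w) → ⊥
    pigeon (inj₁ q)        = u≢v (σ-inj u v q)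
    pigeon (inj₂ (inj₁ q)) = u≢w (σ-inj u w q)
    pigeon (inj₂ (inj₂ q)) = v≢w (σ-inj v w q)

  ⊂⇒up : ∀ {a P} → _⊂_ G (σ a) P → ∃[ p ] Up a p
  ⊂⇒up {a} (_ , x , _ , ax) = dir a (leafOf x) , ¬below (¬σ⁻ ax)

  -- The strong sets `σ b` and the parent's `σ p` both contain `σ a` and cannot overlap; neither
  -- lies strictly below the other, by maximality of the child on one side and `noBetween` on the
  -- other. An edge pointing both ways would make `σ b` everything.
  Child⇒up : ∀ {a b} → Child G (σ a) (σ b) → Up a b
  Child⇒up {a} {b} (_ , _ , lt@(sub , z , bz , az) , max) with p , U ← ⊂⇒up lt with up? p a | inhabited a
  ... | yes U′ | _ = ⊥-elim (σ-noRoot (rootBinary U U′) b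
          (RootEdge.above-full U U′ (σ-strong b) (λ x ax → sub x (σ⁺ ax)) bz (¬σ⁻ az)))
  ... | no ¬U′ | x , ax = subst (Up a) (σ-inj p b (⊆-antisym G p⊆b b⊆p)) U
    where
    p⊂ = child-⊂ U ¬U′
    b⊆p : _⊆_ G (σ b) (σ p)
    b⊆p v bv = ≢false⇒true λ pv → max (σ p) (σ-strong p) p⊂
      ( (λ y py → ≢false⇒true λ by → noOverlap G (σ-strong b) (σ-module p) (sub x (σ⁺ ax))
            (proj₁ p⊂ x (σ⁺ ax)) bv pv by py)
      , v , bv , pv)
    p⊆b : _⊆_ G (σ p) (σ b)
    p⊆b v pv = ≢false⇒true λ bv →
      noBetween U ¬U′ (σ-strong b) (λ y ay → sub y (σ⁺ ay)) bz (¬σ⁻ az) (σ⁻ (b⊆p z bz)) bv (σ⁻ pv)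

  rootChildren-adjacent : ∀ {a b} → RootBinary G → Child G (σ a) (full G) → Child G (σ b) (full G) → a ≢ b → E a b ≡ true
  rootChildren-adjacent {a} {b} root cha@(_ , _ , lt , max) chb a≢b with p , U ← ⊂⇒up lt with up? p a
  ... | no ¬U′ = ⊥-elim (σ-noRoot root p (λ v → ≢false⇒true λ pv →
          max (σ p) (σ-strong p) (child-⊂ U ¬U′) ((λ _ _ → refl) , v , refl , pv)))
  ... | yes U′ with childOfFull-cases U U′ chb
  ...   | inj₁ q = ⊥-elim (a≢b (sym (σ-inj b a q)))
  ...   | inj₂ q = subst (λ v → E a v ≡ true) (sym (σ-inj b p q)) (up-edge U)

  σ-edge : ∀ a b → (E a b ≡ true ⇔
    (Child G (σ a) (σ b) ⊎ Child G (σ b) (σ a)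
     ⊎ (RootBinary G × Child G (σ a) (full G) × Child G (σ b) (full G) × a ≢ b)))
  σ-edge a b = mk⇔ to from
    where
    to : E a b ≡ true → Child G (σ a) (σ b) ⊎ Child G (σ b) (σ a)
      ⊎ (RootBinary G × Child G (σ a) (full G) × Child G (σ b) (full G) × a ≢ b)
    to e with up? a b | up? b a
    ... | yes U | yes U′ = inj₂ (inj₂ (rootBinary U U′ , RootEdge.childOfFull U U′ , RootEdge.childOfFull U′ U , E⇒≢ e))
    ... | yes U | no ¬U′ = inj₁ (child-Child U ¬U′)
    ... | no ¬U | yes U′ = inj₂ (inj₁ (child-Child U′ ¬U))
    ... | no ¬U | no ¬U′ = ⊥-elim ([ ¬U , ¬U′ ]′ (up-total e))
    from : Child G (σ a) (σ b) ⊎ Child G (σ b) (σ a)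
      ⊎ (RootBinary G × Child G (σ a) (full G) × Child G (σ b) (full G) × a ≢ b) → E a b ≡ true
    from (inj₁ ch)        = up-edge (Child⇒up ch)
    from (inj₂ (inj₁ ch)) = swapE (up-edge (Child⇒up ch))
    from (inj₂ (inj₂ (root , cha , chb , a≢b))) = rootChildren-adjacent root cha chb a≢b

  up-⊈ : ∀ {a u} → Up a u → ¬ _⊆_ G (σ u) (σ a)
  up-⊈ {a} U sub with x , ux , ¬ax ← escape-⊈ (E⇒≢ (swapE (up-edge U))) (subst (Up a) (sym (dir-adj (up-edge U))) U) =
    ¬ax (σ⁻ (sub x (σ⁺ ux)))

  -- If `u` or `w` is the parent, the inclusions fail and the right side holds vacuously, in
  -- accordance with the universal parent marker. Otherwise all leaves below both are linked to `a`,
  -- so any pair of representatives decides the label.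
  σ-lab : ∀ a u w → E a u ≡ true → E a w ≡ true → u ≢ w →
    (lab a u w ≡ true ⇔ ((_⊆_ G (σ u) (σ a) × _⊆_ G (σ w) (σ a)) → ModAdj G (σ u) (σ w)))
  σ-lab a u w au aw u≢w with up-total au | up-total aw | up? a u | up? a w
  ... | _ | _ | yes U | _ = mk⇔ (λ _ (sub , _) → ⊥-elim (up-⊈ U sub)) (λ _ → up-universal U aw (u≢w ∘ sym))
  ... | _ | _ | no _ | yes U = mk⇔ (λ _ (_ , sub) → ⊥-elim (up-⊈ U sub))
        (λ _ → trans (lab-sym a u w) (up-universal U au u≢w))
  ... | inj₁ U | _ | no ¬U | no _ = ⊥-elim (¬U U)
  ... | _ | inj₁ U | no _ | no ¬U = ⊥-elim (¬U U)
  ... | inj₂ Uu | inj₂ Uw | no ¬Uu | no ¬Uw = mk⇔ to from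
    where
    na : IsNode T a
    na = parent-node Uu ¬Uu
    to : lab a u w ≡ true → (_⊆_ G (σ u) (σ a) × _⊆_ G (σ w) (σ a)) → ModAdj G (σ u) (σ w)
    to h _ with x , hx , lx ← accessibleLeaf au | y , hy , ly ← accessibleLeaf aw =
      x , y , σ⁺ (child⇒below Uu hx) , σ⁺ (child⇒below Uw hy) , trans (adj-through au aw u≢w hx lx hy ly) h
    from : ((_⊆_ G (σ u) (σ a) × _⊆_ G (σ w) (σ a)) → ModAdj G (σ u) (σ w)) → lab a u w ≡ true
    from h with x , y , ux , wy , xy ← h (proj₁ (child-⊂ Uu ¬Uu) , proj₁ (child-⊂ Uw ¬Uw)) =
      trans (sym (adj-through au aw u≢w
        (below⇒dir Uu (σ⁻ ux)) (linked-below (child-In Uu ¬Uu (σ⁻ ux)))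
        (below⇒dir Uw (σ⁻ wy)) (linked-below (child-In Uw ¬Uw (σ⁻ wy))))) xy

  isModular : IsModularGLT G T
  isModular = record
    { σ = σ ; σ-strong = σ-strong ; σ-inj = σ-inj ; σ-onto = σ-onto ; σ-noRoot = σ-noRoot
    ; σ-edge = σ-edge ; σ-leaf = σ-leaf ; σ-lab = σ-lab }

  cliqueStar : CliqueStar T
  cliqueStar = degenerate

-- Uniqueness of the modular graph-labelled tree

module _ {G : Graph} where

  module Matching {A B : GLT (Graph.n G)} (MA : IsModularGLT G A) (MB : IsModularGLT G B) where
    private
      module A = GLT A
      module B = GLT B
      module MA = IsModularGLT MA
      module MB = IsModularGLT MB

    match : ∀ a → ∃[ b ] _≐_ G (MB.σ b) (MA.σ a)
    match a = MB.σ-onto (MA.σ a) (MA.σ-strong a) (λ (root , h) → MA.σ-noRoot root a h)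

    Same : Fin A.t → Fin B.t → Set
    Same a b = _≐_ G (MA.σ a) (MB.σ b)

    same-unique : ∀ {a b b′} → Same a b → Same a b′ → b ≡ b′
    same-unique h k = MB.σ-inj _ _ (≐-trans G (≐-sym G h) k)

    same-injective : ∀ {a a′ b} → Same a b → Same a′ b → a ≡ a′
    same-injective h k = MA.σ-inj _ _ (≐-trans G h (≐-sym G k))

    edge : ∀ {a a′ b b′} → Same a b → Same a′ b′ → A.E a a′ ≡ true → B.E b b′ ≡ true
    edge {a} {a′} {b} {b′} h k e with Equivalence.to (MA.σ-edge a a′) e
    ... | inj₁ ch        = Equivalence.from (MB.σ-edge b b′) (inj₁ (Child-resp G h k ch))
    ... | inj₂ (inj₁ ch) = Equivalence.from (MB.σ-edge b b′) (inj₂ (inj₁ (Child-resp G k h ch)))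
    ... | inj₂ (inj₂ (root , ch , ch′ , a≢a′)) = Equivalence.from (MB.σ-edge b b′)
          (inj₂ (inj₂ (root , Child-resp G h (λ _ → refl) ch , Child-resp G k (λ _ → refl) ch′ ,
            λ { refl → a≢a′ (same-injective h k) })))

    label : ∀ {v u w v′ u′ w′} → Same v v′ → Same u u′ → Same w w′ → A.E v u ≡ true → A.E v w ≡ true →
      A.lab v u w ≡ true → B.lab v′ u′ w′ ≡ true
    label {v} {u} {w} {v′} {u′} {w′} hv hu hw vu vw h with u ≟ w
    ... | yes refl = ⊥-elim (true≢false h (A.lab-irr v u))
    ... | no u≢w = Equivalence.from (MB.σ-lab v′ u′ w′ (edge hv hu vu) (edge hv hw vw)
            (λ { refl → u≢w (same-injective hu hw) }))
          (λ (su , sw) → ModAdj-resp G hu hw (Equivalence.to (MA.σ-lab v u w vu vw u≢w) h (back hu su , back hw sw)))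
      where
      back : ∀ {x x′} → Same x x′ → _⊆_ G (MB.σ x′) (MB.σ v′) → _⊆_ G (MA.σ x) (MA.σ v)
      back hx s y m = ≐⇒⊆ G (≐-sym G hv) y (s y (≐⇒⊆ G hx y m))

  modular-unique : ∀ {A B : GLT (Graph.n G)} → IsModularGLT G A → IsModularGLT G B → GLTIso A B
  modular-unique {A} {B} MA MB = record
    { φ = φ ; ψ = ψ
    ; ψφ = λ a → AB.same-injective (ψ-same (φ a)) (φ-same a)
    ; φψ = λ b → AB.same-unique (φ-same (ψ b)) (ψ-same b)
    ; E-pres = λ a b → ⇔⇒≡ (AB.edge (φ-same a) (φ-same b)) (BA.edge (flip a) (flip b))
    ; leaf-pres = λ x → AB.same-unique (φ-same (GLT.leafOf A x))
        (≐-trans G (IsModularGLT.σ-leaf MA x) (≐-sym G (IsModularGLT.σ-leaf MB x)))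
    ; lab-pres = λ v u w vu vw → ⇔⇒≡
        (AB.label (φ-same v) (φ-same u) (φ-same w) vu vw)
        (BA.label (flip v) (flip u) (flip w) (AB.edge (φ-same v) (φ-same u) vu) (AB.edge (φ-same v) (φ-same w) vw))
    }
    where
    module AB = Matching MA MB
    module BA = Matching MB MA
    φ : Fin (GLT.t A) → Fin (GLT.t B)
    φ = proj₁ ∘ AB.match
    ψ : Fin (GLT.t B) → Fin (GLT.t A)
    ψ = proj₁ ∘ BA.match
    φ-same : ∀ a → AB.Same a (φ a)
    φ-same a = ≐-sym G (proj₂ (AB.match a))
    ψ-same : ∀ b → AB.Same (ψ b) b
    ψ-same b = proj₂ (BA.match b)
    flip : ∀ a → BA.Same (φ a) a
    flip a = proj₂ (AB.match a)

CliqueStar-resp : ∀ {n} {A B : GLT n} → GLTIso A B → CliqueStar A → CliqueStar B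
CliqueStar-resp {A = A} {B} iso csA v nv = result
  where
  open GLTIso iso
  module A = GLT A
  module B = GLT B
  ψ-inj : ∀ {u w} → ψ u ≡ ψ w → u ≡ w
  ψ-inj {u} {w} q = trans (sym (φψ u)) (trans (cong φ q) (φψ w))
  E-ψ : ∀ a b → A.E (ψ a) (ψ b) ≡ B.E a b
  E-ψ a b = trans (E-pres (ψ a) (ψ b)) (cong₂ B.E (φψ a) (φψ b))
  E-ψ⁺ : ∀ {a b} → B.E a b ≡ true → A.E (ψ a) (ψ b) ≡ true
  E-ψ⁺ e = trans (E-ψ _ _) e
  lab-ψ : ∀ {u w} → B.E v u ≡ true → B.E v w ≡ true → B.lab v u w ≡ A.lab (ψ v) (ψ u) (ψ w)
  lab-ψ {u} {w} vu vw = sym (trans (lab-pres (ψ v) (ψ u) (ψ w) (E-ψ⁺ vu) (E-ψ⁺ vw))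
    (trans (cong (λ a → B.lab a (φ (ψ u)) (φ (ψ w))) (φψ v)) (cong₂ (B.lab v) (φψ u) (φψ w))))
  result : IsCliqueOn (B.E v) (B.lab v) ⊎ IsStarOn (B.E v) (B.lab v)
  result with csA (ψ v) (λ leaf → nv (λ u w vu vw → ψ-inj (leaf (ψ u) (ψ w) (E-ψ⁺ vu) (E-ψ⁺ vw))))
  ... | inj₁ K = inj₁ (λ u w vu vw u≢w → trans (lab-ψ vu vw) (K (ψ u) (ψ w) (E-ψ⁺ vu) (E-ψ⁺ vw) (u≢w ∘ ψ-inj)))
  ... | inj₂ (c , vc , centre , sparse) = inj₂ (φ c , vφc ,
          (λ u vu u≢ → trans (lab-ψ vφc vu)
            (trans (cong (λ d → A.lab (ψ v) d (ψ u)) (ψφ c)) (centre (ψ u) (E-ψ⁺ vu) (≢c u≢)))) ,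
          (λ u w vu vw u≢ w≢ → trans (lab-ψ vu vw) (sparse (ψ u) (ψ w) (E-ψ⁺ vu) (E-ψ⁺ vw) (≢c u≢) (≢c w≢))))
    where
    vφc : B.E v (φ c) ≡ true
    vφc = trans (sym (E-ψ v (φ c))) (trans (cong (A.E (ψ v)) (ψφ c)) vc)
    ≢c : ∀ {u} → u ≢ φ c → ψ u ≢ c
    ≢c {u} u≢ q = u≢ (trans (sym (φψ u)) (cong φ q))

-- From clique-star labels to cographs

module _ {G : Graph} {M : GLT (Graph.n G)} (modular : IsModularGLT G M) (cs : CliqueStar M) where
  open Graph G
  open IsModularGLT modular
  private module M = GLT M

  module InducedP₄ {a b c d} (ab : adj a b ≡ true) (bc : adj b c ≡ true) (cd : adj c d ≡ true)
    (ac : adj a c ≡ false) (ad : adj a d ≡ false) (bd : adj b d ≡ false) where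

    Holds : VSet G → Set
    Holds Q = Mem Q a × Mem Q b × Mem Q c × Mem Q d

    data Corner : Fin n → Set where
      isA : Corner a
      isB : Corner b
      isC : Corner c
      isD : Corner d

    distinct : a ≢ b × a ≢ c × a ≢ d × b ≢ c × b ≢ d × c ≢ d
    distinct = P₄-distinct adj adj-sym adj-irr ab bc cd ac ad bd

    -- A corner adjacent to exactly one of two members of `Q` belongs to `Q`. Starting from any two
    -- corners, this closure reaches all four.
    module-trivial : ∀ {Q x y} → IsModule G Q → Corner x → Corner y → x ≢ y → Mem Q x → Mem Q y → Holds Q
    module-trivial {Q} mq = go
      where
      distinguished : ∀ {x y z} → Mem Q x → Mem Q y → adj x z ≡ true → adj y z ≡ false → Mem Q z
      distinguished Qx Qy xz yz = ≢false⇒true λ Qz → true≢false (trans (sym (mq _ _ _ Qx Qy Qz)) xz) yz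
      rev : ∀ {x y v} → adj x y ≡ v → adj y x ≡ v
      rev {x} {y} h = trans (adj-sym y x) h
      AB : Mem Q a → Mem Q b → Holds Q
      AB qa qb = let qc = distinguished qb qa bc ac in qa , qb , qc , distinguished qc qa cd ad
      AD : Mem Q a → Mem Q d → Holds Q
      AD qa qd = AB qa (distinguished qa qd ab (rev bd))
      AC : Mem Q a → Mem Q c → Holds Q
      AC qa qc = AD qa (distinguished qc qa cd ad)
      BC : Mem Q b → Mem Q c → Holds Q
      BC qb qc = AB (distinguished qb qc (rev ab) (rev ac)) qb
      BD : Mem Q b → Mem Q d → Holds Q
      BD qb qd = AB (distinguished qb qd (rev ab) (rev ad)) qb
      CD : Mem Q c → Mem Q d → Holds Q
      CD qc qd = BC (distinguished qc qd (rev bc) (rev bd)) qc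
      go : ∀ {x y} → Corner x → Corner y → x ≢ y → Mem Q x → Mem Q y → Holds Q
      go isA isA h _ _ = ⊥-elim (h refl)
      go isA isB _ p q = AB p q
      go isA isC _ p q = AC p q
      go isA isD _ p q = AD p q
      go isB isA _ p q = AB q p
      go isB isB h _ _ = ⊥-elim (h refl)
      go isB isC _ p q = BC p q
      go isB isD _ p q = BD p q
      go isC isA _ p q = AC q p
      go isC isB _ p q = BC q p
      go isC isC h _ _ = ⊥-elim (h refl)
      go isC isD _ p q = CD p q
      go isD isA _ p q = AD q p
      go isD isB _ p q = BD q p
      go isD isC _ p q = CD q p
      go isD isD h _ _ = ⊥-elim (h refl)

    corner-in : ∀ {Q x} → Holds Q → Corner x → Mem Q x
    corner-in (h , _ , _ , _) isA = h
    corner-in (_ , h , _ , _) isB = h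
    corner-in (_ , _ , h , _) isC = h
    corner-in (_ , _ , _ , h) isD = h

    other-corner : ∀ {x} → Corner x → ∃[ y ] (Corner y × y ≢ x)
    other-corner isA = b , isB , proj₁ distinct ∘ sym
    other-corner isB = a , isA , proj₁ distinct
    other-corner isC = a , isA , proj₁ (proj₂ distinct)
    other-corner isD = a , isA , proj₁ (proj₂ (proj₂ distinct))

    module Smallest {P : VSet G} (strongP : IsStrong G P) (holds : Holds P)
      (minimal : ∀ Q → IsStrong G Q → _⊂_ G Q P → Holds Q → ⊥) where

      Piece : Fin n → Set
      Piece x = ∃[ C ] (Child G C P × Mem C x)

      -- Deciding whether a strong module lies strictly between `Q` and `P` would mean a search
      -- through all subsets. The goal being absurd, a double negation suffices: a refutation `k` of
      -- all pieces excludes, by recursion, every larger strong module, which makes `Q` itself a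
      -- child of `P`.
      piece : ∀ {x} → Corner x → ¬ ¬ Piece x
      piece {x} cx with y , cy , y≢x ← other-corner cx =
          go (σ (M.leafOf x)) (<-wellFounded _) (σ-strong _) x∈
            ((λ z h → subst (Mem P) (leaf-only h) (corner-in {P} holds cx)) ,
              y , corner-in {P} holds cy , ≢true⇒false (λ h → y≢x (sym (leaf-only h))))
        where
        leaf-only : ∀ {z} → Mem (σ (M.leafOf x)) z → x ≡ z
        leaf-only {z} h with x ≟ z | σ-leaf x z
        ... | yes q | _ = q
        ... | no _  | k = ⊥-elim (true≢false h k)
        x∈ : Mem (σ (M.leafOf x)) x
        x∈ with x ≟ x | σ-leaf x x
        ... | yes _ | k = k
        ... | no h  | _ = ⊥-elim (h refl)
        go : ∀ Q → Acc _<_ (count (not ∘ Q)) → IsStrong G Q → Mem Q x → _⊂_ G Q P → ¬ ¬ Piece x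
        go Q (acc rs) strong Qx lt k = k (Q , (strong , strongP , lt , λ Q′ strong′ (sub , z , Q′z , Qz) lt′ →
          go Q′ (rs (count-strict (not ∘ Q′) (not ∘ Q)
                (λ i h → cong not (≢true⇒false (λ Qi → true≢false (sub i Qi) (Bool.not-injective h))))
                z (cong not Q′z) (cong not Qz)))
             strong′ (sub x Qx) lt′ k) , Qx)

      -- By `module-trivial`, a child with two corners would contain all four, against the
      -- minimality of `P`.
      piece-only : ∀ {x y} → Corner x → Corner y → x ≢ y → ((C , _) : Piece x) → C y ≡ false
      piece-only cx cy x≢y (C , (strong@(_ , mC , _) , _ , lt , _) , Cx) =
        ≢true⇒false (λ Cy → minimal C strong lt (module-trivial mC cx cy x≢y Cx Cy))

      pieces-disjoint : ∀ {x y} → Corner x → Corner y → x ≢ y → ((C , _) : Piece x) ((D , _) : Piece y) →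
        ∀ z → Mem C z → D z ≡ false
      pieces-disjoint cx cy x≢y X@(C , (strong , _) , Cx) Y@(D , ((_ , mD , _) , _) , Dy) z Cz =
        ≢true⇒false (λ Dz → noOverlap G strong mD Cz Dz Cx (piece-only cy cx (x≢y ∘ sym) Y)
          (piece-only cx cy x≢y X) Dy)

      pieces-≐ : ∀ {x y} → Corner x → Corner y → x ≢ y → ((C , _) : Piece x) ((D , _) : Piece y) → ¬ _≐_ G C D
      pieces-≐ {x} cx cy x≢y X@(C , _ , Cx) Y h =
        true≢false (trans (sym (h x)) Cx) (piece-only cy cx (x≢y ∘ sym) Y)

      -- A contracted root has only two children, but three corners already lie in three different
      -- ones. Hence `P` is represented by a vertex of the tree.
      notRoot : Piece a → Piece b → Piece c → ¬ (RootBinary G × _≐_ G P (full G))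
      notRoot X@(A , chA , _) Y@(B , chB , _) Z@(C , chC , _) ((_ , _ , _ , _ , _ , only) , h)
        with ab≢ , ac≢ , _ , bc≢ , _ ← distinct
        with two-classes G (only A (toFull chA)) (only B (toFull chB)) (only C (toFull chC))
        where
        toFull : ∀ {D} → Child G D P → Child G D (full G)
        toFull = Child-resp G (λ _ → refl) h
      ... | inj₁ q        = pieces-≐ isA isB ab≢ X Y q
      ... | inj₂ (inj₁ q) = pieces-≐ isA isC ac≢ X Z q
      ... | inj₂ (inj₂ q) = pieces-≐ isB isC bc≢ Y Z q

      node-of : ∀ {x} → ((C , _) : Piece x) → ∃[ u ] _≐_ G (σ u) C
      node-of (C , (strong , _ , (_ , y , _ , Cy) , _) , _) =
        σ-onto C strong (λ (_ , h) → true≢false (h y) Cy)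

      module Label (v : Fin M.t) (vP : _≐_ G (σ v) P) where

        marker : ∀ {x} → Piece x → Fin M.t
        marker X = proj₁ (node-of X)

        marker-child : ∀ {x} (X : Piece x) → Child G (σ (marker X)) (σ v)
        marker-child X@(_ , ch , _) = Child-resp G (≐-sym G (proj₂ (node-of X))) (≐-sym G vP) ch

        marker-edge : ∀ {x} (X : Piece x) → M.E v (marker X) ≡ true
        marker-edge X = Equivalence.from (σ-edge v (marker X)) (inj₂ (inj₁ (marker-child X)))

        marker-≢ : ∀ {x y} → Corner x → Corner y → x ≢ y → (X : Piece x) (Y : Piece y) → marker X ≢ marker Y
        marker-≢ cx cy x≢y X Y q = pieces-≐ cx cy x≢y X Y (≐-trans G (≐-sym G (proj₂ (node-of X)))
          (subst (λ u → _≐_ G (σ u) (proj₁ Y)) (sym q) (proj₂ (node-of Y))))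

        -- The label speaks of some adjacent pair `x′`, `y′` of representatives. The children are
        -- disjoint modules, so `y′` can be exchanged for `y` and `x′` for `x`.
        lab-adj : ∀ {x y} → Corner x → Corner y → x ≢ y → (X : Piece x) (Y : Piece y) →
          M.lab v (marker X) (marker Y) ≡ adj x y
        lab-adj {x} {y} cx cy x≢y X@(C , ((_ , mC , _) , _) , Cx) Y@(D , ((_ , mD , _) , _) , Dy) =
          ⇔⇒≡ (λ h → modAdj⇒adj (Equivalence.to σ-lab-XY h
                  (proj₁ (proj₁ (proj₂ (proj₂ (marker-child X)))) , proj₁ (proj₁ (proj₂ (proj₂ (marker-child Y)))))))
               (λ h → Equivalence.from σ-lab-XY (λ _ → x , y , ≐⇒⊆ G (≐-sym G (proj₂ (node-of X))) x Cx ,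
                  ≐⇒⊆ G (≐-sym G (proj₂ (node-of Y))) y Dy , h))
          where
          σ-lab-XY = σ-lab v (marker X) (marker Y) (marker-edge X) (marker-edge Y) (marker-≢ cx cy x≢y X Y)
          modAdj⇒adj : ModAdj G (σ (marker X)) (σ (marker Y)) → adj x y ≡ true
          modAdj⇒adj (x′ , y′ , hx , hy , h) =
            trans (adj-sym x y) (trans (mD y y′ x Dy Dy′ (piece-only cy cx (x≢y ∘ sym) Y))
              (trans (adj-sym y′ x) (trans (mC x x′ y′ Cx (≐⇒⊆ G (proj₂ (node-of X)) x′ hx)
                (pieces-disjoint cy cx (x≢y ∘ sym) Y X y′ Dy′)) h)))
            where
            Dy′ : Mem D y′
            Dy′ = ≐⇒⊆ G (proj₂ (node-of Y)) y′ hy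

      contradiction : Piece a → Piece b → Piece c → Piece d → ⊥
      contradiction A B C D
        with v , vP ← σ-onto P strongP (notRoot A B C)
        with ab≢ , ac≢ , ad≢ , bc≢ , bd≢ , cd≢ ← distinct = absurd (cs v node)
        where
        open Label v vP
        node : IsNode M v
        node leaf = marker-≢ isA isB ab≢ A B (leaf _ _ (marker-edge A) (marker-edge B))
        absurd : IsCliqueOn (M.E v) (M.lab v) ⊎ IsStarOn (M.E v) (M.lab v) → ⊥
        absurd (inj₁ K) = true≢false (K _ _ (marker-edge A) (marker-edge C) (marker-≢ isA isC ac≢ A C))
          (trans (lab-adj isA isC ac≢ A C) ac)
        -- In a star the edges of the P₄ from `a` to `b` and from `c` to `d` would both have to end
        -- at the centre, but they share no vertex.
        absurd (inj₂ (e , _ , _ , sparse)) with marker A ≟ e | marker B ≟ e | marker C ≟ e | marker D ≟ e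
        ... | yes p | _     | yes q | _     = marker-≢ isA isC ac≢ A C (trans p (sym q))
        ... | yes p | _     | no _  | yes q = marker-≢ isA isD ad≢ A D (trans p (sym q))
        ... | no _  | yes p | yes q | _     = marker-≢ isB isC bc≢ B C (trans p (sym q))
        ... | no _  | yes p | no _  | yes q = marker-≢ isB isD bd≢ B D (trans p (sym q))
        ... | no p  | no q  | _     | _     = true≢false (trans (lab-adj isA isB ab≢ A B) ab)
                (sparse _ _ (marker-edge A) (marker-edge B) p q)
        ... | _     | _     | no p  | no q  = true≢false (trans (lab-adj isC isD cd≢ C D) cd)
                (sparse _ _ (marker-edge C) (marker-edge D) p q)

    -- Descent in place of the choice of a smallest strong module: the minimality required by
    -- `Smallest` is the induction hypothesis.
    impossible : ∀ P → IsStrong G P → Holds P → ⊥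
    impossible P = go P (<-wellFounded _)
      where
      go : ∀ P → Acc _<_ (count P) → IsStrong G P → Holds P → ⊥
      go P (acc rs) strong holds =
        piece isA λ A → piece isB λ B → piece isC λ C → piece isD λ D → contradiction A B C D
        where
        open Smallest {P} strong holds
          (λ Q strongQ (sub , x , Px , Qx) → go Q (rs (count-strict Q P sub x Qx Px)) strongQ)

  cliqueStar⇒cograph : Cograph G
  cliqueStar⇒cograph (a , _ , _ , _ , _ , _ , _ , _ , _ , _ , ab , bc , cd , ac , ad , bd) =
    InducedP₄.impossible ab bc cd ac ad bd (full G) (full-strong G a) (refl , refl , refl , refl)

mainTheorem3 : (G : Graph) → Connected G →
    (S M : GLT (Graph.n G)) → IsSplitTree G S → IsModularGLT G M →
    (Cograph G ⇔ (GLTIso S M × CliqueStar M))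
mainTheorem3 G conn S M splitTree modular = mk⇔ to (λ (_ , cs) → cliqueStar⇒cograph modular cs)
  where
  to : Cograph G → GLTIso S M × CliqueStar M
  to cograph = iso , CliqueStar-resp iso cliqueStar
    where
    open ModularOfSplit G conn cograph S splitTree using (isModular; cliqueStar)
    iso : GLTIso S M
    iso = modular-unique isModular modular
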